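{- Let $\mathcal{D}$ be a balanced quadriculated disk. Suppose that $\mathcal{D}$ contains a unit square $s$ such that $\mathcal{D}\smallsetminus s$ has at least three connected components. If the largest connected component of $\mathcal{D}\smallsetminus s$ has size at most $|\mathcal{D}|-4$, then $\mathcal{D}$ is strongly irregular.
   Context: A quadriculated disk $\mathcal{D}\subset\mathbb{R}^2$ is a finite union of closed unit squares with vertices in $\mathbb{Z}^2$ that is homeomorphic to a closed disk. The unit square $[a,a+1]\times[b,b+1]$, $(a,b)\in\mathbb{Z}^2$, is white if $a+b$ is even and black if $a+b$ is odd. Two unit squares are adjacent if they share an edge; a planar domino is a union of two adjacent unit squares. $\mathcal{D}$ is balanced if it contains equally many white and black unit squares. The size $|\cdot|$ of a union of unit squares is its number of unit squares. Connected components of $\mathcal{D}\smallsetminus s$ are identified with the corresponding sets of unit squares (connected via shared edges). Domino group. A plug is a union $p\subseteq\mathcal{D}$ of unit squares of $\mathcal{D}$ with equally many white and black squares; $\mathbf{p}_\circ=\emptyset$ is the empty plug. Two plugs are disjoint if their interiors are disjoint. The 2-complex $\mathcal{C}_{\mathcal{D}}$ is defined as follows. - Vertices: the plugs. - Edges: for every two distinct disjoint plugs $p_1,p_2$, one edge between $p_1$ and $p_2$ for each planar domino tiling of $\mathcal{D}\smallsetminus\mathrm{int}(p_1\cup p_2)$ (the empty region has exactly one tiling, the empty one); also one loop at $\mathbf{p}_\circ$ for each planar domino tiling of $\mathcal{D}$. - 2-cells: (i) for each loop $f$, a disk attached along $f*f$ (so that a projective plane results); (ii) for each two edges joining the same two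 distinct plugs whose tilings differ by a single planar flip (replacing two parallel dominoes forming a $2\times2$ square by the other two), a disk attached along the resulting bigon; (iii) for each four plugs $p_1,p_2,p_3,p_4$ with $p_2$ disjoint from $p_1$ and from $p_4$, and $p_2=p_3\cup d$ where $d$ is a domino whose two unit squares are not in $p_3$, and for each tiling $f_1^*$ of $\mathcal{D}\smallsetminus\mathrm{int}(p_1\cup p_2)$ and each tiling $f_2^*$ of $\mathcal{D}\smallsetminus\mathrm{int}(p_2\cup p_4)$, a disk attached along the quadrilateral $p_1\to p_2\to p_4\to p_3\to p_1$ with edges $f_1^*$, $f_2^*$, $f_2^*\cup\{d\}$, $f_1^*\cup\{d\}$. The domino group is $G_{\mathcal{D}}=\pi_1(\mathcal{C}_{\mathcal{D}},\mathbf{p}_\circ)$. The even domino group $G_{\mathcal{D}}^+$ is the kernel of the homomorphism $G_{\mathcal{D}}\to\mathbb{Z}/(2)$ sending a closed edge path of length $N$ to $N \bmod 2$. The disk $\mathcal{D}$ is strongly irregular if there exists a surjective homomorphism from $G_{\mathcal{D}}^+$ onto the free group $F_2$ of rank two. -}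

module Defs where

open import Algebra.Bundles using (Group)
open import Algebra.Morphism.Structures using (IsGroupHomomorphism)
open import Data.Fin.Base using (Fin)
open import Data.Fin.Subset
  using (Subset; _∈_; _∉_; _∩_; _∪_; ∁; ⊥; ⁅_⁆; _⊆_; Nonempty; Empty)
  renaming (∣_∣ to card)
open import Data.Fin.Subset.Properties using (∩-comm; ∪-comm; ∩-zeroˡ)
open import Data.Integer.Base as ℤ using (ℤ)
open import Data.Nat.Base as ℕ using (ℕ; suc; parity)
open import Data.Parity.Base as ℙ using (Parity; 0ℙ; 1ℙ)
import Data.Parity.Properties as ℙ
open import Data.Product using (Σ; ∃; _×_; _,_; proj₁; proj₂)
open import Data.Rational.Base as ℚ using (ℚ; 0ℚ; 1ℚ)
import Data.Rational.Properties as ℚ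
open import Data.Vec.Base using (Vec; lookup; tabulate; _[_]≔_)
open import Function.Bundles using (_⇔_)
open import Function.Definitions using (Injective; Surjective)
open import Level using (Level; 0ℓ; _⊔_)
open import Relation.Binary.Construct.Closure.ReflexiveTransitive
  using (Star; ε; _◅_; _◅◅_; reverse; revApp)
open import Relation.Binary.Construct.Closure.ReflexiveTransitive.Properties
  using (◅◅-assoc)
open import Relation.Binary.PropositionalEquality
  using (_≡_; _≢_; refl; sym; trans; cong; cong₂; subst)
open import Relation.Nullary using (¬_; does)

------------------------------------------------------------------------
-- Subsets of the real plane

-- u ≲ v means lim u ≤ lim v, when u and v converge.

infix 4 _≲_

_≲_ : (ℕ → ℚ) → (ℕ → ℚ) → Set
u ≲ v = ∀ e → 0ℚ ℚ.< e → ∃ λ N → ∀ n → N ℕ.≤ n → u n ℚ.≤ v n ℚ.+ e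

const : ℚ → ℕ → ℚ
const q _ = q

-- Real numbers are represented by Cauchy sequences of rationals, with the
-- equality given on points of the plane by _≈ₚ_ below.

record ℝ : Set where
  field
    seq    : ℕ → ℚ
    cauchy : ∀ e → 0ℚ ℚ.< e → ∃ λ N → ∀ m n → N ℕ.≤ m → N ℕ.≤ n →
             ℚ.∣ seq m ℚ.- seq n ∣ ℚ.≤ e

open ℝ public

Point : Set
Point = ℝ × ℝ

dist : ℝ → ℝ → ℕ → ℚ
dist x y n = ℚ.∣ seq x n ℚ.- seq y n ∣

-- Within e p q: the distance of p and q in the maximum norm is at most e.

Within : ℚ → Point → Point → Set
Within e (x , y) (x′ , y′) = dist x x′ ≲ const e × dist y y′ ≲ const e

infix 4 _≈ₚ_

_≈ₚ_ : Point → Point → Set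
_≈ₚ_ = Within 0ℚ

PlaneSet : Set₁
PlaneSet = Point → Set

Continuous : (A B : PlaneSet) → (Σ Point A → Σ Point B) → Set
Continuous A B f =
  ∀ (a : Σ Point A) e → 0ℚ ℚ.< e →
  ∃ λ d → 0ℚ ℚ.< d ×
    (∀ (a′ : Σ Point A) → Within d (proj₁ a) (proj₁ a′) →
     Within e (proj₁ (f a)) (proj₁ (f a′)))

-- Continuous maps respect _≈ₚ_, so that no separate congruence fields
-- are needed.

record Homeomorphic (A B : PlaneSet) : Set where
  field
    to              : Σ Point A → Σ Point B
    from            : Σ Point B → Σ Point A
    to-continuous   : Continuous A B to
    from-continuous : Continuous B A from
    from∘to         : ∀ a → proj₁ (from (to a)) ≈ₚ proj₁ a
    to∘from         : ∀ b → proj₁ (to (from b)) ≈ₚ proj₁ b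

closedDisk : PlaneSet
closedDisk (x , y) =
  (λ n → seq x n ℚ.* seq x n ℚ.+ seq y n ℚ.* seq y n) ≲ const 1ℚ

------------------------------------------------------------------------
-- Finite unions of unit squares

-- (a , b) stands for the unit square [a,a+1] × [b,b+1].

Square : Set
Square = ℤ × ℤ

fromℤ : ℤ → ℚ
fromℤ a = a ℚ./ 1

unitSquare : Square → PlaneSet
unitSquare (a , b) (x , y) =
  (const (fromℤ a) ≲ seq x × seq x ≲ const (fromℤ (ℤ.suc a))) ×
  (const (fromℤ b) ≲ seq y × seq y ≲ const (fromℤ (ℤ.suc b)))

color : Square → Parity
color (a , b) = parity ℤ.∣ a ℤ.+ b ∣

white : Parity
white = 0ℙ

Adjacent : Square → Square → Set
Adjacent (a , b) (a′ , b′) = ℤ.∣ a ℤ.- a′ ∣ ℕ.+ ℤ.∣ b ℤ.- b′ ∣ ≡ 1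

-- A finite union of unit squares, given by an enumeration of its squares.
-- Unions of some of these squares are then elements of Subset size.

record Region : Set where
  field
    size      : ℕ
    square    : Fin size → Square
    injective : Injective _≡_ _≡_ square

-- The double negation makes this the closed union: constructively one
-- cannot decide on which side of a shared edge a given real point lies.

underlying : Region → PlaneSet
underlying D p = ¬ ¬ ∃ λ i → unitSquare (Region.square D i) p

IsQuadriculatedDisk : Region → Set
IsQuadriculatedDisk D = Homeomorphic (underlying D) closedDisk

module _ (D : Region) where
  open Region D

  Adj : Fin size → Fin size → Set
  Adj i j = Adjacent (square i) (square j)

  whites : Subset size
  whites = tabulate λ i → does (color (square i) ℙ.≟ white)

  Balanced : Subset size → Set
  Balanced r = card (r ∩ whites) ≡ card (r ∩ ∁ whites)

  ----------------------------------------------------------------------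
  -- Connected components of unions of squares

  Connected : Subset size → Fin size → Fin size → Set
  Connected r = Star (λ i j → i ∈ r × j ∈ r × Adj i j)

  record IsComponent (r c : Subset size) : Set where
    field
      nonempty : Nonempty c
      inside   : c ⊆ r
      class    : ∀ {i} → i ∈ c → ∀ j → j ∈ c ⇔ Connected r i j

  AtLeastThreeComponents : Subset size → Set
  AtLeastThreeComponents r =
    ∃ λ c₁ → ∃ λ c₂ → ∃ λ c₃ →
      IsComponent r c₁ × IsComponent r c₂ × IsComponent r c₃ ×
      c₁ ≢ c₂ × c₁ ≢ c₃ × c₂ ≢ c₃

  ----------------------------------------------------------------------
  -- Domino tilings

  -- A set of disjoint dominoes is encoded by the vector sending each covered
  -- square to its partner and each other square to itself.

  Mates : Set
  Mates = Vec (Fin size) size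

  record Tiles (r : Subset size) (m : Mates) : Set where
    field
      adjacent   : ∀ i → i ∈ r → Adj i (lookup m i)
      closed     : ∀ i → i ∈ r → lookup m i ∈ r
      involutive : ∀ i → i ∈ r → lookup m (lookup m i) ≡ i
      outside    : ∀ i → i ∉ r → lookup m i ≡ i

  addDomino : Fin size → Fin size → Mates → Mates
  addDomino i j m = (m [ i ]≔ j) [ j ]≔ i

  -- i , j are the lower and k , l the upper squares of a 2 × 2 square; m has
  -- its two horizontal dominoes and m′ its two vertical ones.

  record HorizontalToVertical (m m′ : Mates) : Set where
    field
      i j k l : Fin size
      a b     : ℤ
      at-i    : square i ≡ (a , b)
      at-j    : square j ≡ (ℤ.suc a , b)
      at-k    : square k ≡ (a , ℤ.suc b)
      at-l    : square l ≡ (ℤ.suc a , ℤ.suc b)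
      before  : lookup m i ≡ j × lookup m j ≡ i × lookup m k ≡ l × lookup m l ≡ k
      after   : lookup m′ i ≡ k × lookup m′ k ≡ i × lookup m′ j ≡ l × lookup m′ l ≡ j
      same    : ∀ x → x ≢ i → x ≢ j → x ≢ k → x ≢ l → lookup m x ≡ lookup m′ x

  ----------------------------------------------------------------------
  -- The complex

  record Plug : Set where
    constructor plug
    field
      cells     : Subset size
      .balanced : Balanced cells

  open Plug public

  emptyPlug : Plug
  emptyPlug = plug ⊥ (trans (cong card (∩-zeroˡ whites))
                            (sym (cong card (∩-zeroˡ (∁ whites)))))

  -- An edge together with an endpoint from which it is traversed. If p and q
  -- are disjoint and equal then both are empty, and the edge is a loop given
  -- by a tiling of the whole region. A loop has only one traversal here; this
  -- does not affect the fundamental group, in which the cell attached along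
  -- f * f makes f equal to its inverse.

  record Edge (p q : Plug) : Set where
    constructor edge
    field
      mates     : Mates
      .disjoint : Empty (cells p ∩ cells q)
      .tiles    : Tiles (∁ (cells p ∪ cells q)) mates

  open Edge public

  flip : ∀ {p q} → Edge p q → Edge q p
  flip {p} {q} (edge m d t) = edge m
    (subst Empty (∩-comm (cells p) (cells q)) d)
    (subst (λ r → Tiles (∁ r) m) (∪-comm (cells p) (cells q)) t)

  Path : Plug → Plug → Set
  Path = Star Edge

  -- Homotopy of edge paths: the least congruence that cancels an edge against
  -- its reversal and contracts the boundary of each 2-cell.

  infix 4 _≃_

  data _≃_ : ∀ {p q} → Path p q → Path p q → Set where
    ≃-refl    : ∀ {p q} {α : Path p q} → α ≃ α
    ≃-sym     : ∀ {p q} {α β : Path p q} → α ≃ β → β ≃ α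
    ≃-trans   : ∀ {p q} {α β γ : Path p q} → α ≃ β → β ≃ γ → α ≃ γ
    ◅◅-cong   : ∀ {p q r} {α α′ : Path p q} {β β′ : Path q r} →
                α ≃ α′ → β ≃ β′ → α ◅◅ β ≃ α′ ◅◅ β′
    backtrack : ∀ {p q} (f : Edge p q) → f ◅ flip f ◅ ε ≃ ε

    loop-cell : (f : Edge emptyPlug emptyPlug) → f ◅ f ◅ ε ≃ ε

    flip-cell : ∀ {p q} → p ≢ q → (f g : Edge p q) →
                HorizontalToVertical (mates f) (mates g) →
                f ◅ flip g ◅ ε ≃ ε

    domino-cell : ∀ {p₁ p₂ p₃ p₄} (i j : Fin size) → Adj i j →
                  i ∉ cells p₃ → j ∉ cells p₃ →
                  cells p₂ ≡ cells p₃ ∪ (⁅ i ⁆ ∪ ⁅ j ⁆) →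
                  (f₁ : Edge p₁ p₂) (f₂ : Edge p₂ p₄)
                  (g₂ : Edge p₄ p₃) (g₁ : Edge p₃ p₁) →
                  mates g₂ ≡ addDomino i j (mates f₂) →
                  mates g₁ ≡ addDomino i j (mates f₁) →
                  f₁ ◅ f₂ ◅ g₂ ◅ g₁ ◅ ε ≃ ε

  ----------------------------------------------------------------------
  -- The domino group

  private
    rev : ∀ {p q} → Path p q → Path q p
    rev = reverse flip

    ≡⇒≃ : ∀ {p q} {α β : Path p q} → α ≡ β → α ≃ β
    ≡⇒≃ refl = ≃-refl

    ◅◅-ε : ∀ {p q} (α : Path p q) → α ◅◅ ε ≡ α
    ◅◅-ε ε       = refl
    ◅◅-ε (f ◅ α) = cong (f ◅_) (◅◅-ε α)

    revApp-◅◅ : ∀ {p q r} (α : Path q p) (β : Path q r) →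
                revApp flip α β ≡ rev α ◅◅ β
    revApp-◅◅ ε       β = refl
    revApp-◅◅ (f ◅ α) β = trans (revApp-◅◅ α (flip f ◅ β))
      (trans (sym (◅◅-assoc (rev α) (flip f ◅ ε) β))
             (cong (_◅◅ β) (sym (revApp-◅◅ α (flip f ◅ ε)))))

    inverseʳ : ∀ {p q} (α : Path p q) → α ◅◅ rev α ≃ ε
    inverseʳ ε       = ≃-refl
    inverseʳ (f ◅ α) =
      ≃-trans (≡⇒≃ (cong (f ◅_) (trans (cong (α ◅◅_) (revApp-◅◅ α (flip f ◅ ε)))
                                      (sym (◅◅-assoc α (rev α) (flip f ◅ ε))))))
      (≃-trans (◅◅-cong {α = f ◅ ε} ≃-refl
                 (◅◅-cong {β = flip f ◅ ε} (inverseʳ α) ≃-refl))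
               (backtrack f))

    inverseˡ : ∀ {p q} (α : Path p q) → rev α ◅◅ α ≃ ε
    inverseˡ ε       = ≃-refl
    inverseˡ (f ◅ α) =
      ≃-trans (≡⇒≃ (trans (cong (_◅◅ (f ◅ α)) (revApp-◅◅ α (flip f ◅ ε)))
                          (◅◅-assoc (rev α) (flip f ◅ ε) (f ◅ α))))
      (≃-trans (◅◅-cong {α = rev α} ≃-refl
                 (◅◅-cong {α = flip f ◅ f ◅ ε} {β = α} (backtrack (flip f)) ≃-refl))
               (inverseˡ α))

    rev-cong : ∀ {p q} {α β : Path p q} → α ≃ β → rev α ≃ rev β
    rev-cong {α = α} {β} α≃β =
      ≃-trans (≡⇒≃ (sym (◅◅-ε (rev α))))
      (≃-trans (◅◅-cong {α = rev α} ≃-refl (≃-sym (inverseʳ β)))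
      (≃-trans (◅◅-cong {α = rev α} ≃-refl
                 (◅◅-cong {β = rev β} (≃-sym α≃β) ≃-refl))
      (≃-trans (≡⇒≃ (sym (◅◅-assoc (rev α) α (rev β))))
               (◅◅-cong {β = rev β} (inverseˡ α) ≃-refl))))

  dominoGroup : Group 0ℓ 0ℓ
  dominoGroup = record
    { Carrier = Path emptyPlug emptyPlug
    ; _≈_     = _≃_
    ; _∙_     = _◅◅_
    ; ε       = ε
    ; _⁻¹     = reverse flip
    ; isGroup = record
      { isMonoid = record
        { isSemigroup = record
          { isMagma = record
            { isEquivalence = record { refl = ≃-refl ; sym = ≃-sym ; trans = ≃-trans }
            ; ∙-cong        = ◅◅-cong
            }
          ; assoc = λ α β γ → ≡⇒≃ (◅◅-assoc α β γ)
          }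
        ; identity = (λ _ → ≃-refl) , (λ α → ≡⇒≃ (◅◅-ε α))
        }
      ; inverse = inverseˡ , inverseʳ
      ; ⁻¹-cong = rev-cong
      }
    }

  length : ∀ {p q} → Path p q → ℕ
  length ε       = 0
  length (_ ◅ α) = suc (length α)

  lengthParity : ∀ {p q} → Path p q → Parity
  lengthParity α = parity (length α)

  private
    lengthParity-◅◅ : ∀ {p q r} (α : Path p q) (β : Path q r) →
                      lengthParity (α ◅◅ β) ≡ lengthParity α ℙ.+ lengthParity β
    lengthParity-◅◅ α β = trans (cong parity (length-◅◅ α)) (ℙ.+-homo-+ (length α) (length β))
      where
      length-◅◅ : ∀ {p} (α : Path p _) → length (α ◅◅ β) ≡ length α ℕ.+ length β
      length-◅◅ ε       = refl
      length-◅◅ (_ ◅ α) = cong suc (length-◅◅ α)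

    lengthParity-cong : ∀ {p q} {α β : Path p q} → α ≃ β →
                        lengthParity α ≡ lengthParity β
    lengthParity-cong ≃-refl        = refl
    lengthParity-cong (≃-sym e)     = sym (lengthParity-cong e)
    lengthParity-cong (≃-trans e f) = trans (lengthParity-cong e) (lengthParity-cong f)
    lengthParity-cong (◅◅-cong {α = α} {α′} {β} {β′} e f) =
      trans (lengthParity-◅◅ α β)
      (trans (cong₂ ℙ._+_ (lengthParity-cong e) (lengthParity-cong f))
             (sym (lengthParity-◅◅ α′ β′)))
    lengthParity-cong (backtrack _)                             = refl
    lengthParity-cong (loop-cell _)                             = refl
    lengthParity-cong (flip-cell _ _ _ _)                       = refl
    lengthParity-cong (domino-cell _ _ _ _ _ _ _ _ _ _ _ _)    = refl

    self-inverse : ∀ x y → x ℙ.+ y ≡ 0ℙ → x ≡ y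
    self-inverse 0ℙ 0ℙ _ = refl
    self-inverse 1ℙ 1ℙ _ = refl

  lengthParity-isGroupHomomorphism :
    IsGroupHomomorphism (Group.rawGroup dominoGroup) (Group.rawGroup ℙ.+-0-group) lengthParity
  lengthParity-isGroupHomomorphism = record
    { isMonoidHomomorphism = record
      { isMagmaHomomorphism = record
        { isRelHomomorphism = record { cong = lengthParity-cong }
        ; homo = lengthParity-◅◅
        }
      ; ε-homo = refl
      }
    ; ⁻¹-homo = λ α → self-inverse _ _
        (trans (sym (lengthParity-◅◅ (rev α) α)) (lengthParity-cong (inverseˡ α)))
    }

------------------------------------------------------------------------
-- Groups

module _ {a ℓ b m : Level} (G : Group a ℓ) (H : Group b m)
         (φ : Group.Carrier G → Group.Carrier H)
         (hom : IsGroupHomomorphism (Group.rawGroup G) (Group.rawGroup H) φ) where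
  private
    module G = Group G
    module H = Group H
    open IsGroupHomomorphism hom

  kernel : Group (a ⊔ m) ℓ
  kernel = record
    { Carrier = Σ G.Carrier λ g → φ g H.≈ H.ε
    ; _≈_     = λ g h → proj₁ g G.≈ proj₁ h
    ; _∙_     = λ { (g , p) (h , q) → g G.∙ h ,
                    H.trans (homo g h) (H.trans (H.∙-cong p q) (H.identityˡ H.ε)) }
    ; ε       = G.ε , ε-homo
    ; _⁻¹     = λ { (g , p) → g G.⁻¹ ,
                    H.trans (⁻¹-homo g) (H.trans (H.⁻¹-cong p)
                      (H.trans (H.sym (H.identityʳ _)) (H.inverseˡ H.ε))) }
    ; isGroup = record
      { isMonoid = record
        { isSemigroup = record
          { isMagma = record
            { isEquivalence = record { refl = G.refl ; sym = G.sym ; trans = G.trans }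
            ; ∙-cong        = G.∙-cong
            }
          ; assoc = λ g h k → G.assoc (proj₁ g) (proj₁ h) (proj₁ k)
          }
        ; identity = (λ g → G.identityˡ (proj₁ g)) , (λ g → G.identityʳ (proj₁ g))
        }
      ; inverse = (λ g → G.inverseˡ (proj₁ g)) , (λ g → G.inverseʳ (proj₁ g))
      ; ⁻¹-cong = G.⁻¹-cong
      }
    }

-- The free group on X: group terms modulo the consequences of the group axioms.

module FreeGroup (X : Set) where

  infixl 7 _∙_
  infix  8 _⁻¹
  infix  4 _≈_

  data Term : Set where
    gen : X → Term
    e   : Term
    _∙_ : Term → Term → Term
    _⁻¹ : Term → Term

  data _≈_ : Term → Term → Set where
    ≈-refl    : ∀ {x} → x ≈ x
    ≈-sym     : ∀ {x y} → x ≈ y → y ≈ x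
    ≈-trans   : ∀ {x y z} → x ≈ y → y ≈ z → x ≈ z
    ∙-cong    : ∀ {x x′ y y′} → x ≈ x′ → y ≈ y′ → x ∙ y ≈ x′ ∙ y′
    ⁻¹-cong   : ∀ {x y} → x ≈ y → x ⁻¹ ≈ y ⁻¹
    assoc     : ∀ x y z → (x ∙ y) ∙ z ≈ x ∙ (y ∙ z)
    identityˡ : ∀ x → e ∙ x ≈ x
    identityʳ : ∀ x → x ∙ e ≈ x
    inverseˡ  : ∀ x → x ⁻¹ ∙ x ≈ e
    inverseʳ  : ∀ x → x ∙ x ⁻¹ ≈ e

freeGroup : Set → Group 0ℓ 0ℓ
freeGroup X = record
  { Carrier = Term
  ; _≈_     = _≈_
  ; _∙_     = _∙_
  ; ε       = e
  ; _⁻¹     = _⁻¹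
  ; isGroup = record
    { isMonoid = record
      { isSemigroup = record
        { isMagma = record
          { isEquivalence = record { refl = ≈-refl ; sym = ≈-sym ; trans = ≈-trans }
          ; ∙-cong        = ∙-cong
          }
        ; assoc = assoc
        }
      ; identity = identityˡ , identityʳ
      }
    ; inverse = inverseˡ , inverseʳ
    ; ⁻¹-cong = ⁻¹-cong
    }
  }
  where open FreeGroup X

SurjectsOnto : Group 0ℓ 0ℓ → Group 0ℓ 0ℓ → Set
SurjectsOnto G H =
  ∃ λ (φ : Group.Carrier G → Group.Carrier H) →
    IsGroupHomomorphism (Group.rawGroup G) (Group.rawGroup H) φ ×
    Surjective (Group._≈_ G) (Group._≈_ H) φ

evenDominoGroup : Region → Group 0ℓ 0ℓ
evenDominoGroup D =
  kernel (dominoGroup D) ℙ.+-0-group (lengthParity D) (lengthParity-isGroupHomomorphism D)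

StronglyIrregular : Region → Set
StronglyIrregular D = SurjectsOnto (evenDominoGroup D) (freeGroup (Fin 2))

module Submission where

-- A path in the complex is a sequence of floors, along which we follow the
-- partner of the square s. Let T be a union of components of D ∖ s, and let w
-- be a weight on squares which is opposite on adjacent squares other than s.
-- Label a floor between the plugs p and q in which the partner of s lies in T
-- by h (w p) if it is in even position, by h (w q)⁻¹ if it is in odd position,
-- and the other floors by 1. The product of the labels respects every 2-cell:
-- flips do not move the partner of s to another component, and if a domino
-- cell covers s by its domino then w p₁ = w p₄, since both complement w p₂.
--
-- Let w be 1 or −1 according to the colour on one component, the opposite of
-- that on a second one, and 0 elsewhere; write w also for its sums over plugs.
-- Let h be 1, a, b on zero, positive and negative numbers. Adding and removing dominoes one at a time, one builds a
-- closed path around s which passes three components and uses a second square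
-- u of one of them only; its label is h (w t + w u). Two such paths have labels
-- a and b. The size condition provides the squares u; if each of the
-- three given components is a single square, the balance of D does.
--
-- Connectedness of the adjacency graph of D, needed for every component to
-- touch s, is where the disk is used. The lattice corners in D have finitely
-- many preimages in the round disk; two points of it are joined by a path of
-- axis-parallel rational segments keeping a positive distance from these. Along
-- such a path the image stays away from all corners, so rational
-- approximations decide in which part of a disconnected D it lies, and
-- bisection produces a point at which the part would jump.

open import Defs
open import Algebra.Bundles using (AbelianGroup; Group)
open import Algebra.Morphism.Structures using (IsGroupHomomorphism)
import Algebra.Properties.Group as GroupProperties
import Algebra.Solver.IdempotentCommutativeMonoid as UnionSolver
open import Data.Bool.Base using (Bool; true; false; if_then_else_; not; _∨_)
import Data.Empty as Empty
open import Data.Fin.Base using (Fin; zero; suc)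
open import Data.Fin.Permutation using (permutation)
import Data.Fin.Properties as Fin
open import Data.Integer.Base as ℤ using (ℤ; +_; -[1+_]; 0ℤ; 1ℤ; -1ℤ)
import Data.Integer.Properties as ℤ
open import Data.Integer.Tactic.RingSolver using () renaming (ring to ℤ-ring)
open import Data.List.Base using (List; _∷_; []; map; allFin; cartesianProduct)
open import Data.Nat.Base as ℕ using (ℕ; parity)
import Data.Nat.Properties as ℕ
open import Data.Parity.Base as ℙ using (Parity; 0ℙ; 1ℙ)
import Data.Parity.Properties as ℙ
open import Data.Product using (Σ; ∃; ∃₂; _×_; _,_; proj₁; proj₂)
open import Data.Sum.Base using (_⊎_; inj₁; inj₂; [_,_]′)
open import Data.Vec.Base as Vec using (lookup; _[_]≔_)
open import Data.Vec.Properties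
  using (lookup-zipWith; lookup-map; lookup∘tabulate; lookup-replicate; lookup-allFin;
         lookup∘update; lookup∘update′; []=⇒lookup; lookup⇒[]=)
open import Function.Base using (_∘_)
open import Function.Bundles using (module Equivalence)
open import Level using (0ℓ)
open import Relation.Binary.Construct.Closure.ReflexiveTransitive using (ε; _◅_; _◅◅_)
open import Relation.Binary.Definitions using (tri<; tri≈; tri>)
open import Relation.Binary.PropositionalEquality
  using (_≡_; _≢_; refl; sym; trans; cong; cong₂; subst; subst₂; module ≡-Reasoning)
open import Relation.Nullary using (¬_; Dec; yes; no; does; contradiction)
open import Relation.Nullary.Decidable
  using (_×-dec_; _⊎-dec_; ¬?; map′; decidable-stable; recompute; dec⇒maybe)
open import Relation.Unary using (Pred; Decidable)
open import Tactic.RingSolver using (solve)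

-- Adjacency of unit squares.

suc[i]≢i : ∀ a → ℤ.suc a ≢ a
suc[i]≢i a eq = ℤ.<-irrefl (sym eq) (ℤ.suc[i]≤j⇒i<j ℤ.≤-refl)

∣a-a∣≡0 : ∀ a → ℤ.∣ a ℤ.- a ∣ ≡ 0
∣a-a∣≡0 a = cong ℤ.∣_∣ (ℤ.+-inverseʳ a)

∣suc-a∣≡1 : ∀ a → ℤ.∣ ℤ.suc a ℤ.- a ∣ ≡ 1
∣suc-a∣≡1 a = cong ℤ.∣_∣ (trans (ℤ.+-assoc 1ℤ a (ℤ.- a)) (cong (ℤ._+_ 1ℤ) (ℤ.+-inverseʳ a)))

∣a-suc∣≡1 : ∀ a → ℤ.∣ a ℤ.- ℤ.suc a ∣ ≡ 1
∣a-suc∣≡1 a = trans (ℤ.∣i-j∣≡∣j-i∣ a (ℤ.suc a)) (∣suc-a∣≡1 a)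

adj-sym : ∀ p q → Adjacent p q → Adjacent q p
adj-sym (a , b) (a′ , b′) = trans (cong₂ ℕ._+_ (ℤ.∣i-j∣≡∣j-i∣ a′ a) (ℤ.∣i-j∣≡∣j-i∣ b′ b))

right-adjacent : ∀ a b → Adjacent (ℤ.suc a , b) (a , b)
right-adjacent a b = cong₂ ℕ._+_ (∣suc-a∣≡1 a) (∣a-a∣≡0 b)

upper-adjacent : ∀ a b → Adjacent (a , ℤ.suc b) (a , b)
upper-adjacent a b = cong₂ ℕ._+_ (∣a-a∣≡0 a) (∣suc-a∣≡1 b)

-- Connectedness of quadriculated disks

module Plane where
  open import Data.Empty using (⊥)
  open import Data.List.Membership.Propositional using () renaming (_∈_ to _∈ₗ_)
  open import Data.List.Membership.Propositional.Properties using (∈-map⁺; ∈-cartesianProduct⁺; ∈-allFin)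
  open import Data.List.Relation.Unary.All as All using (All)
  import Data.List.Relation.Unary.All.Properties as All
  open import Data.List.Relation.Unary.Any using (here; there)
  open import Data.Nat.Base using (zero; suc)
  import Data.Nat.Coprimality as Coprime
  open import Data.Rational.Base as ℚ using (ℚ; 0ℚ; 1ℚ; ½; mkℚ; _+_; _-_; _*_; -_; _≤_; _<_)
  open import Data.Rational.Properties as ℚ
    using (≤-trans; ≤-refl; <⇒≤; _≤?_; +-*-commutativeRing; +-mono-≤; +-mono-<-≤)
  open import Tactic.RingSolver.Core.AlmostCommutativeRing using (AlmostCommutativeRing; fromCommutativeRing)

  -- Ordered arithmetic of the rationals.

  ℚ-ring : AlmostCommutativeRing 0ℓ 0ℓ
  ℚ-ring = fromCommutativeRing +-*-commutativeRing (λ x → dec⇒maybe (0ℚ ℚ.≟ x))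

  -- Linear inequalities are proved by certificates: the difference of the two
  -- sides is exhibited as a sum of nonnegative terms and checked by the solver.
  lin : ∀ {x y z} → 0ℚ ≤ z → x + z ≡ y → x ≤ y
  lin {x} {y} {z} p q = subst₂ _≤_ (ℚ.+-identityʳ x) q (ℚ.+-monoʳ-≤ x p)

  lin< : ∀ {x y z} → 0ℚ < z → x + z ≡ y → x < y
  lin< {x} {y} {z} p q = subst₂ _<_ (ℚ.+-identityʳ x) q (ℚ.+-monoʳ-< x p)

  infixl 5 _⊕_ _⊕<_
  _⊕_ : ∀ {a b} → 0ℚ ≤ a → 0ℚ ≤ b → 0ℚ ≤ a + b
  _⊕_ = +-mono-≤

  _⊕<_ : ∀ {a b} → 0ℚ < a → 0ℚ ≤ b → 0ℚ < a + b
  _⊕<_ = +-mono-<-≤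

  Δ : ∀ {x y} → x ≤ y → 0ℚ ≤ y - x
  Δ {x} {y} p = subst (_≤ y - x) (ℚ.+-inverseʳ x) (ℚ.+-monoˡ-≤ (- x) p)

  Δ< : ∀ {x y} → x < y → 0ℚ < y - x
  Δ< {x} {y} p = subst (_< y - x) (ℚ.+-inverseʳ x) (ℚ.+-monoˡ-< (- x) p)

  absurd : ∀ {A : Set} {z} → 0ℚ < z → z ≡ 0ℚ → A
  absurd p q = contradiction (sym q) (ℚ.<⇒≢ p)

  infixl 6 _⊗_ _⊗<_
  _⊗_ : ∀ {a b} → 0ℚ ≤ a → 0ℚ ≤ b → 0ℚ ≤ a * b
  _⊗_ {a} {b} p q = subst (_≤ a * b) (ℚ.*-zeroʳ a) (ℚ.*-monoˡ-≤-nonNeg a {{ℚ.nonNegative p}} q)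

  _⊗<_ : ∀ {a b} → 0ℚ < a → 0ℚ < b → 0ℚ < a * b
  _⊗<_ {a} {b} p q = subst (_< a * b) (ℚ.*-zeroʳ a) (ℚ.*-monoʳ-<-pos a {{ℚ.positive p}} q)

  0<½ : 0ℚ < ½
  0<½ = ℚ.positive⁻¹ ½

  0<1 : 0ℚ < 1ℚ
  0<1 = ℚ.positive⁻¹ 1ℚ

  half-pos : ∀ {k} → 0ℚ < k → 0ℚ < ½ * k
  half-pos = 0<½ ⊗<_

  -- Reals and their rational approximations.

  slack : ∀ {a b} → (∀ k → 0ℚ < k → a ≤ b + k) → a ≤ b
  slack {a} {b} f with a ≤? b
  ... | yes p = p
  ... | no a≰b = absurd (half-pos b<a ⊕< Δ (f (½ * (a - b)) (half-pos b<a))) (solve (a ∷ b ∷ []) ℚ-ring)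
    where b<a = Δ< (ℚ.≰⇒> a≰b)

  -- The bound on the absolute value is split into two linear inequalities, the form in which
  -- certificates for `lin` can be given.
  record Close (d a b : ℚ) : Set where
    constructor _,_
    field
      upper : a ≤ b + d
      lower : b ≤ a + d

  open Close

  abs⇒close : ∀ {a b d} → ℚ.∣ a - b ∣ ≤ d → Close d a b
  abs⇒close {a} {b} {d} p with ℚ.≤-total 0ℚ (a - b)
  ... | inj₁ q = lin (Δ a-b≤d) (solve (a ∷ b ∷ d ∷ []) ℚ-ring) ,
                 lin (q ⊕ q ⊕ Δ a-b≤d) (solve (a ∷ b ∷ d ∷ []) ℚ-ring)
    where a-b≤d = subst (_≤ d) (ℚ.0≤p⇒∣p∣≡p q) p
  ... | inj₂ q = lin (Δ q ⊕ Δ q ⊕ Δ b-a≤d) (solve (a ∷ b ∷ d ∷ []) ℚ-ring) ,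
                 lin (Δ b-a≤d) (solve (a ∷ b ∷ d ∷ []) ℚ-ring)
    where
    b-a≤d : - (a - b) ≤ d
    b-a≤d = subst (_≤ d) (trans (sym (ℚ.∣-p∣≡∣p∣ (a - b))) (ℚ.0≤p⇒∣p∣≡p (ℚ.neg-antimono-≤ q))) p

  close⇒abs : ∀ {a b d} → Close d a b → ℚ.∣ a - b ∣ ≤ d
  close⇒abs {a} {b} {d} (p , q) with ℚ.∣p∣≡p∨∣p∣≡-p (a - b)
  ... | inj₁ e = subst (_≤ d) (sym e) (lin (Δ p) (solve (a ∷ b ∷ d ∷ []) ℚ-ring))
  ... | inj₂ e = subst (_≤ d) (sym e) (lin (Δ q) (solve (a ∷ b ∷ d ∷ []) ℚ-ring))

  close-sym : ∀ {d a b} → Close d a b → Close d b a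
  close-sym (p , q) = q , p

  close-weaken : ∀ {d d′ a b} → d ≤ d′ → Close d a b → Close d′ a b
  close-weaken {a = a} {b} p (q , r) = ≤-trans q (ℚ.+-monoʳ-≤ b p) , ≤-trans r (ℚ.+-monoʳ-≤ a p)

  close-trans : ∀ {d d′ a b c} → Close d a b → Close d′ b c → Close (d + d′) a c
  close-trans {d} {d′} {a} {b} {c} (p , q) (p′ , q′) =
    lin (Δ p ⊕ Δ p′) (solve (a ∷ b ∷ c ∷ d ∷ d′ ∷ []) ℚ-ring) ,
    lin (Δ q ⊕ Δ q′) (solve (a ∷ b ∷ c ∷ d ∷ d′ ∷ []) ℚ-ring)

  close-refl : ∀ {d a} → 0ℚ ≤ d → Close d a a
  close-refl {d} {a} p = q , q
    where
    q : a ≤ a + d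
    q = lin p refl

  -- Wrapped in a record since `dist x y ≲ const e` unfolds to a function type from which `e`, `x`
  -- and `y` are hard to infer. At `e = 0ℚ` this is equality of reals.
  record Near (e : ℚ) (x y : ℝ) : Set where
    constructor near
    field dist≲ : dist x y ≲ const e

  near⇒close : ∀ {e x y} → Near e x y → ∀ {k} → 0ℚ < k →
               ∃ λ N → ∀ n → N ℕ.≤ n → Close (e + k) (seq x n) (seq y n)
  near⇒close (near p) k>0 = let (N , f) = p _ k>0 in N , λ n N≤n → abs⇒close (f n N≤n)

  close⇒near : ∀ {e x y} → (∃ λ N → ∀ n → N ℕ.≤ n → Close e (seq x n) (seq y n)) → Near e x y
  close⇒near {e} (N , f) = near λ k k>0 → N , λ n N≤n →
    close⇒abs (close-weaken (lin (<⇒≤ k>0) refl) (f n N≤n))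

  ι : ℚ → ℝ
  ι q = record
    { seq    = const q
    ; cauchy = λ e e>0 → 0 , λ _ _ _ _ → close⇒abs {q} {q} (close-refl (<⇒≤ e>0))
    }

  near-sym : ∀ {e x y} → Near e x y → Near e y x
  near-sym {x = x} {y} p = near λ k k>0 → let (N , f) = near⇒close p k>0 in
    N , λ n N≤n → close⇒abs {seq y n} {seq x n} (close-sym (f n N≤n))

  near-weaken : ∀ {e e′ x y} → e ≤ e′ → Near e x y → Near e′ x y
  near-weaken e≤e′ (near p) = near λ k k>0 → let (N , f) = p k k>0 in
    N , λ n N≤n → ≤-trans (f n N≤n) (ℚ.+-monoˡ-≤ k e≤e′)

  near-trans : ∀ {e e′ x y z} → Near e x y → Near e′ y z → Near (e + e′) x z
  near-trans {e} {e′} {x} {y} {z} p q = near λ k k>0 →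
    let (N , f) = near⇒close p (half-pos k>0)
        (M , g) = near⇒close q (half-pos k>0)
    in N ℕ.⊔ M , λ n N⊔M≤n →
      close⇒abs {seq x n} {seq z n} (subst (λ d → Close d _ _) (eq k)
        (close-trans (f n (ℕ.≤-trans (ℕ.m≤m⊔n N M) N⊔M≤n))
                     (g n (ℕ.≤-trans (ℕ.m≤n⊔m N M) N⊔M≤n))))
    where
    eq : ∀ k → e + ½ * k + (e′ + ½ * k) ≡ e + e′ + k
    eq k = solve (e ∷ e′ ∷ k ∷ []) ℚ-ring

  near-ι : ∀ {e p q} → Near e (ι p) (ι q) → Close e p q
  near-ι {e} {p} {q} h =
    slack (λ k k>0 → lift {p} {q} (upper (c k k>0))) ,
    slack (λ k k>0 → lift {q} {p} (lower (c k k>0)))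
    where
    c : ∀ k → 0ℚ < k → Close (e + k) p q
    c k k>0 = let (N , f) = near⇒close h k>0 in f N ℕ.≤-refl
    lift : ∀ {a b k} → a ≤ b + (e + k) → a ≤ b + e + k
    lift {a} {b} {k} = subst (a ≤_) (sym (ℚ.+-assoc b e k))

  ι-near : ∀ {e p q} → Close e p q → Near e (ι p) (ι q)
  ι-near c = close⇒near (0 , λ _ _ → c)

  approx : ∀ (x : ℝ) {e} → 0ℚ < e → ∃ λ q → Near e x (ι q)
  approx x {e} e>0 = let (N , f) = cauchy x e e>0 in
    seq x N , close⇒near (N , λ n N≤n → abs⇒close (f n N N≤n ℕ.≤-refl))

  -- The slacks in `_≲_` and in `Near` are both taken as `½ * k` with `k` arbitrary, so `slack`
  -- removes their sum.
  below : ∀ {a e q} x → const a ≲ seq x → Near e x (ι q) → a ≤ q + e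
  below {a} {e} {q} x p h = slack λ k k>0 →
    let (N , f) = p _ (half-pos k>0)
        (M , g) = near⇒close h (half-pos k>0)
        s = f (N ℕ.⊔ M) (ℕ.m≤m⊔n N M)
        t = upper (g (N ℕ.⊔ M) (ℕ.m≤n⊔m N M))
    in aux {k = k} s t
    where
    aux : ∀ {y k} → a ≤ y + ½ * k → y ≤ q + (e + ½ * k) → a ≤ q + e + k
    aux {y} {k} s t = lin (Δ s ⊕ Δ t) (solve (a ∷ y ∷ k ∷ q ∷ e ∷ []) ℚ-ring)

  above : ∀ {b e q} x → seq x ≲ const b → Near e x (ι q) → q ≤ b + e
  above {b} {e} {q} x p h = slack λ k k>0 →
    let (N , f) = p _ (half-pos k>0)
        (M , g) = near⇒close h (half-pos k>0)
        s = f (N ℕ.⊔ M) (ℕ.m≤m⊔n N M)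
        t = lower (g (N ℕ.⊔ M) (ℕ.m≤n⊔m N M))
    in aux {k = k} s t
    where
    aux : ∀ {y k} → y ≤ b + ½ * k → q ≤ y + (e + ½ * k) → q ≤ b + e + k
    aux {y} {k} s t = lin (Δ s ⊕ Δ t) (solve (b ∷ y ∷ k ∷ q ∷ e ∷ []) ℚ-ring)

  -- Integers inside the rationals and the Archimedean property.

  fromℤ≡ : ∀ a → fromℤ a ≡ mkℚ a 0 (Coprime.sym (Coprime.1-coprimeTo ℤ.∣ a ∣))
  fromℤ≡ a = ℚ.↥p/↧p≡p (mkℚ a 0 _)

  fromℤ-suc : ∀ a → fromℤ (ℤ.suc a) ≡ 1ℚ + fromℤ a
  fromℤ-suc a rewrite fromℤ≡ a = sym (cong (ℚ._/ 1) (cong (ℤ._+_ (+ 1)) (ℤ.*-identityʳ a)))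

  fromℤ-cancel-< : ∀ {a b} → fromℤ a < fromℤ b → a ℤ.< b
  fromℤ-cancel-< {a} {b} p with subst₂ _<_ (fromℤ≡ a) (fromℤ≡ b) p
  ... | ℚ.*<* q = subst₂ ℤ._<_ (ℤ.*-identityʳ a) (ℤ.*-identityʳ b) q

  pow2 : ℕ → ℚ
  pow2 zero    = 1ℚ
  pow2 (suc n) = pow2 n + pow2 n

  1≤pow2 : ∀ n → 1ℚ ≤ pow2 n
  1≤pow2 zero = ≤-refl
  1≤pow2 (suc n) = lin (Δ (1≤pow2 n) ⊕ Δ (1≤pow2 n) ⊕ <⇒≤ 0<1) (eq (pow2 n))
    where
    eq : ∀ p → 1ℚ + (p - 1ℚ + (p - 1ℚ) + 1ℚ) ≡ p + p
    eq p = solve (p ∷ []) ℚ-ring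

  n≤pow2 : ∀ n → fromℤ (+ n) ≤ pow2 n
  n≤pow2 zero = <⇒≤ 0<1
  n≤pow2 (suc n) = subst (_≤ pow2 n + pow2 n) (sym (fromℤ-suc (+ n))) (+-mono-≤ (1≤pow2 n) (n≤pow2 n))

  q≤pow2 : ∀ q → ∃ λ n → q ≤ pow2 n
  q≤pow2 q@(mkℚ (+ a) d _) = a , ≤-trans q≤a (n≤pow2 a)
    where
    q≤a : q ≤ fromℤ (+ a)
    q≤a = subst (q ≤_) (sym (fromℤ≡ (+ a))) (ℚ.*≤* (ℤ.*-monoˡ-≤-nonNeg (+ a) (ℤ.+≤+ (ℕ.s≤s ℕ.z≤n))))
  q≤pow2 q@(mkℚ ℤ.-[1+ a ] d _) = 0 , <⇒≤ (ℚ.neg<pos q 1ℚ)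

  halves : ℕ → ℚ → ℚ
  halves zero    x = x
  halves (suc n) x = ½ * halves n x

  -- `n` is chosen with `x / e ≤ 2 ^ n`, by way of `n ≤ 2 ^ n`. The induction in `aux` doubles `e`
  -- while it removes one halving of `x`.
  archimedean : ∀ x {e} → 0ℚ < e → ∃ λ n → halves n x ≤ e
  archimedean x {e} e>0 = let (n , p) = q≤pow2 (x * inv) in n , aux n e x (bound (pow2 n) p)
    where
    instance
      e≢0 = ℚ.>-nonZero e>0
    inv = ℚ.1/ e
    aux : ∀ n e x → x ≤ pow2 n * e → halves n x ≤ e
    aux zero e x p = subst (x ≤_) (ℚ.*-identityˡ e) p
    aux (suc n) e x p = lin (<⇒≤ 0<½ ⊗ Δ (aux n (e + e) x (subst (x ≤_) (eq (pow2 n)) p))) (eq₂ (halves n x))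
      where
      eq : ∀ q → (q + q) * e ≡ q * (e + e)
      eq q = solve (q ∷ e ∷ []) ℚ-ring
      eq₂ : ∀ h → ½ * h + ½ * (e + e - h) ≡ e
      eq₂ h = solve (h ∷ e ∷ []) ℚ-ring
    bound : ∀ k → x * inv ≤ k → x ≤ k * e
    bound k p = subst (_≤ k * e)
      (trans (ℚ.*-assoc x inv e) (trans (cong (x *_) (ℚ.*-inverseˡ e)) (ℚ.*-identityʳ x)))
      (ℚ.*-monoʳ-≤-nonNeg e {{ℚ.nonNegative (<⇒≤ e>0)}} p)

  record Minimum (a b : ℚ) : Set where
    constructor minimum
    field
      {value}  : ℚ
      positive : 0ℚ < value
      ≤ˡ       : value ≤ a
      ≤ʳ       : value ≤ b

  min-pos : ∀ {a b} → 0ℚ < a → 0ℚ < b → Minimum a b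
  min-pos {a} {b} p q with ℚ.≤-total a b
  ... | inj₁ a≤b = minimum p ≤-refl a≤b
  ... | inj₂ b≤a = minimum q b≤a ≤-refl

  -- Bisection.

  Between : ℚ → ℚ → ℚ → Set
  Between l r x = l ≤ x × x ≤ r

  l+[r-l]≡r : ∀ l r → l + (r - l) ≡ r
  l+[r-l]≡r l r = solve (l ∷ r ∷ []) ℚ-ring

  two-halves : ∀ a w → a + ½ * w + ½ * w ≡ a + w
  two-halves a w = solve (a ∷ w ∷ []) ℚ-ring

  module Bisection {Q : Pred ℚ 0ℓ} (Q? : Decidable Q) {l r : ℚ} (l≤r : l ≤ r)
                   (Ql : Q l) (¬Qr : ¬ Q r) where

    width : ℕ → ℚ
    width n = halves n (r - l)

    next : ∀ a w → Dec (Q (a + w)) → ℚ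
    next a w (yes _) = a + w
    next a w (no _)  = a

    -- Only the left end is stored, the right end being `lo n + width n`. Throughout, `Q` holds at
    -- the former and fails at the latter.
    lo : ℕ → ℚ
    lo zero    = l
    lo (suc n) = next (lo n) (width (suc n)) (Q? (lo n + width (suc n)))

    0≤width : ∀ n → 0ℚ ≤ width n
    0≤width zero    = Δ l≤r
    0≤width (suc n) = <⇒≤ 0<½ ⊗ 0≤width n

    next-Q : ∀ {a w} d → Q a → Q (next a w d)
    next-Q (yes q) _ = q
    next-Q (no _)  q = q

    next-¬Q : ∀ {a w} d → ¬ Q (a + w) → ¬ Q (next a (½ * w) d + ½ * w)
    next-¬Q {a} {w} (yes _) ¬q = ¬q ∘ subst Q (two-halves a w)
    next-¬Q (no ¬q) _ = ¬q

    next-nested : ∀ {a w} d → 0ℚ ≤ ½ * w → a ≤ next a (½ * w) d × next a (½ * w) d + ½ * w ≤ a + w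
    next-nested {a} {w} (yes _) 0≤w = lin 0≤w refl , ℚ.≤-reflexive (two-halves a w)
    next-nested {a} {w} (no _)  0≤w = ≤-refl , lin 0≤w (two-halves a w)

    Q-lo : ∀ n → Q (lo n)
    Q-lo zero = Ql
    Q-lo (suc n) = next-Q (Q? _) (Q-lo n)

    ¬Q-hi : ∀ n → ¬ Q (lo n + width n)
    ¬Q-hi zero q = ¬Qr (subst Q (l+[r-l]≡r l r) q)
    ¬Q-hi (suc n) = next-¬Q (Q? _) (¬Q-hi n)

    nested : ∀ n → lo n ≤ lo (suc n) × lo (suc n) + width (suc n) ≤ lo n + width n
    nested n = next-nested (Q? _) (0≤width (suc n))

    nested⁺ : ∀ k n → lo n ≤ lo (k ℕ.+ n) × lo (k ℕ.+ n) + width (k ℕ.+ n) ≤ lo n + width n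
    nested⁺ zero n = ≤-refl , ≤-refl
    nested⁺ (suc k) n = let (p , q) = nested⁺ k n ; (p′ , q′) = nested (k ℕ.+ n) in
      ≤-trans p p′ , ≤-trans q′ q

    lo-between : ∀ {m n} → n ℕ.≤ m → Between (lo n) (lo n + width n) (lo m)
    lo-between {m} {n} n≤m =
      let (p , q) = subst (λ k → lo n ≤ lo k × lo k + width k ≤ lo n + width n)
                          (ℕ.m∸n+n≡m n≤m) (nested⁺ (m ℕ.∸ n) n)
      in p , ≤-trans (lin (0≤width m) refl) q

    close-between : ∀ {a w e x y} → w ≤ e → Between a (a + w) x → Between a (a + w) y → Close e x y
    close-between {a} {w} {e} {x} {y} w≤e (p , q) (p′ , q′) =
      lin (Δ w≤e ⊕ Δ q ⊕ Δ p′) (solve (a ∷ w ∷ e ∷ x ∷ y ∷ []) ℚ-ring) ,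
      lin (Δ w≤e ⊕ Δ q′ ⊕ Δ p) (solve (a ∷ w ∷ e ∷ x ∷ y ∷ []) ℚ-ring)

    limit : ℝ
    limit = record
      { seq    = lo
      ; cauchy = λ e e>0 → let (N , w≤e) = archimedean (r - l) e>0 in
          N , λ m n N≤m N≤n → close⇒abs (close-between w≤e (lo-between N≤m) (lo-between N≤n))
      }

    lo-range : ∀ n → Between l r (lo n)
    lo-range n = let (p , q) = lo-between {n} ℕ.z≤n in p , subst (lo n ≤_) (l+[r-l]≡r l r) q

    hi-range : ∀ n → Between l r (lo n + width n)
    hi-range n = ≤-trans (proj₁ (lo-range n)) (lin (0≤width n) refl) ,
      subst₂ _≤_ (cong (λ k → lo k + width k) (ℕ.+-identityʳ n)) (l+[r-l]≡r l r) (proj₂ (nested⁺ n 0))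

    -- The two ends of one interval of the nesting serve as `a` and `b`: the tail of `lo` stays in
    -- that interval, so `limit` is within its width of both.
    jump : ∀ {e} → 0ℚ < e → ∃₂ λ a b → Between l r a × Between l r b × Q a × ¬ Q b ×
           Near e limit (ι a) × Near e limit (ι b)
    jump {e} e>0 = let (N , w≤e) = archimedean (r - l) e>0 in
      lo N , lo N + width N , lo-range N , hi-range N , Q-lo N , ¬Q-hi N ,
      close⇒near (N , λ n N≤n → close-between w≤e (lo-between N≤n) (≤-refl , lin (0≤width N) refl)) ,
      close⇒near (N , λ n N≤n → close-between w≤e (lo-between N≤n) (lin (0≤width N) refl , ≤-refl))

  -- Intervals that avoid finitely many reals.

  avoid-step : ∀ x {l η} → 0ℚ < η → let r = l + (η + η + (η + η)) in
    ∃₂ λ l′ r′ → l ≤ l′ × l′ < r′ × r′ ≤ r × ∀ c → Between l′ r′ c → ¬ Near (½ * η) (ι c) x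
  -- On which side of the midpoint the real `x` lies cannot be decided, but the side of a rational
  -- `q` within `½ * η` of it can. The end piece of length `½ * η` on the other side keeps a
  -- distance of more than `η` from `q`.
  avoid-step x {l} {η} η>0 = by-side (ℚ.≤-total q (l + (η + η)))
    where
    η≥0 = <⇒≤ η>0
    q = proj₁ (approx x (half-pos η>0))
    c~q : ∀ {c} → Near (½ * η) (ι c) x → Close (½ * η + ½ * η) c q
    c~q c~x = near-ι (near-trans c~x (proj₂ (approx x (half-pos η>0))))
    right : ∀ {c q} → q ≤ l + (η + η) → l + (η + η) + (η + ½ * η) ≤ c → c ≤ q + (½ * η + ½ * η) → ⊥
    right {c} {q} p p′ p″ =
      absurd (half-pos η>0 ⊕< Δ p ⊕< Δ p′ ⊕< Δ p″) (solve (l ∷ η ∷ c ∷ q ∷ []) ℚ-ring)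
    left : ∀ {c q} → l + (η + η) ≤ q → c ≤ l + ½ * η → q ≤ c + (½ * η + ½ * η) → ⊥
    left {c} {q} p p′ p″ =
      absurd (half-pos η>0 ⊕< Δ p ⊕< Δ p′ ⊕< Δ p″) (solve (l ∷ η ∷ c ∷ q ∷ []) ℚ-ring)
    by-side : q ≤ l + (η + η) ⊎ l + (η + η) ≤ q → _
    by-side (inj₁ q≤mid) = l + (η + η) + (η + ½ * η) , l + (η + η + (η + η)) ,
      lin (η≥0 ⊕ η≥0 ⊕ η≥0 ⊕ <⇒≤ (half-pos η>0)) (solve (l ∷ η ∷ []) ℚ-ring) ,
      lin< (half-pos η>0) (solve (l ∷ η ∷ []) ℚ-ring) , ≤-refl ,
      λ c (l′≤c , _) c~x → right q≤mid l′≤c (upper (c~q c~x))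
    by-side (inj₂ mid≤q) = l , l + ½ * η , ≤-refl , lin< (half-pos η>0) refl ,
      lin (η≥0 ⊕ η≥0 ⊕ η≥0 ⊕ <⇒≤ (half-pos η>0)) (solve (l ∷ η ∷ []) ℚ-ring) ,
      λ c (_ , c≤r′) c~x → left mid≤q c≤r′ (lower (c~q c~x))

  record Gap (l r : ℚ) (xs : List ℝ) : Set where
    constructor gap
    field
      {left right margin} : ℚ
      l≤left     : l ≤ left
      left<right : left < right
      right≤r    : right ≤ r
      margin>0   : 0ℚ < margin
      clear      : All (λ x → ∀ c → Between left right c → ¬ Near margin (ι c) x) xs

    clear-left : ∀ {μ} → μ ≤ margin → All (λ x → ¬ Near μ (ι left) x) xs
    clear-left μ≤ = All.map (λ f → f left (≤-refl , <⇒≤ left<right) ∘ near-weaken μ≤) clear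

  avoid : ∀ (xs : List ℝ) {l r} → l < r → Gap l r xs
  avoid [] l<r = gap ≤-refl l<r ≤-refl 0<1 All.[]
  avoid (x ∷ xs) {l₀} {r₀} l₀<r₀ =
    let gap {l} {r} l₀≤l l<r r≤r₀ μ>0 away = avoid xs l₀<r₀
        -- `η` is a quarter of the length, so the interval of length four `η` in `avoid-step` is the
        -- whole gap found so far.
        η>0 = half-pos (half-pos (Δ< l<r))
        (l′ , r′ , l≤l′ , l′<r′ , r′≤ , away′) = avoid-step x {l} η>0
        r′≤r = subst (r′ ≤_) (quarters l r) r′≤
        minimum m>0 m≤μ m≤η = min-pos μ>0 (half-pos η>0)
    in gap (≤-trans l₀≤l l≤l′) l′<r′ (≤-trans r′≤r r≤r₀) m>0
       ((λ c c∈ → away′ c c∈ ∘ near-weaken m≤η) All.∷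
        All.map (λ f c (p , q) → f c (≤-trans l≤l′ p , ≤-trans q r′≤r) ∘ near-weaken m≤μ) away)
    where
    quarters : ∀ l r → let η = ½ * (½ * (r - l)) in l + (η + η + (η + η)) ≡ r
    quarters l r = solve (l ∷ r ∷ []) ℚ-ring

  -- Points of the plane and thickened unit squares.

  record Nearₚ (e : ℚ) (p q : Point) : Set where
    constructor nearₚ
    field
      near₁ : Near e (proj₁ p) (proj₁ q)
      near₂ : Near e (proj₂ p) (proj₂ q)

  open Nearₚ

  within⇒nearₚ : ∀ {e p q} → Within e p q → Nearₚ e p q
  within⇒nearₚ (p , q) = nearₚ (near p) (near q)

  nearₚ⇒within : ∀ {e p q} → Nearₚ e p q → Within e p q
  nearₚ⇒within (nearₚ (near p) (near q)) = p , q

  nearₚ-sym : ∀ {e p q} → Nearₚ e p q → Nearₚ e q p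
  nearₚ-sym (nearₚ p q) = nearₚ (near-sym p) (near-sym q)

  nearₚ-weaken : ∀ {e e′ p q} → e ≤ e′ → Nearₚ e p q → Nearₚ e′ p q
  nearₚ-weaken h (nearₚ p q) = nearₚ (near-weaken h p) (near-weaken h q)

  nearₚ-trans : ∀ {e e′ p q r} → Nearₚ e p q → Nearₚ e′ q r → Nearₚ (e + e′) p r
  nearₚ-trans (nearₚ p q) (nearₚ p′ q′) = nearₚ (near-trans p p′) (near-trans q q′)

  near-refl : ∀ {e x} → 0ℚ ≤ e → Near e x x
  near-refl 0≤e = close⇒near (0 , λ _ _ → close-refl 0≤e)

  ιₚ : ℚ × ℚ → Point
  ιₚ (x , y) = ι x , ι y

  -- A point of the interval is known only up to `e`. The thickened condition holds for each of its
  -- `e`-approximations and, concerning rationals, is decidable.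
  record InSide (e : ℚ) (a : ℤ) (x : ℚ) : Set where
    constructor _,_
    field
      left  : fromℤ a ≤ x + e
      right : x ≤ fromℤ (ℤ.suc a) + e

  inSide? : ∀ e a x → Dec (InSide e a x)
  inSide? e a x = map′ (λ (p , q) → p , q) (λ (p , q) → p , q)
    ((fromℤ a ≤? x + e) ×-dec (x ≤? fromℤ (ℤ.suc a) + e))

  InBox : ℚ → Square → ℚ × ℚ → Set
  InBox e (a , b) (x , y) = InSide e a x × InSide e b y

  inBox? : ∀ e s p → Dec (InBox e s p)
  inBox? e (a , b) (x , y) = inSide? e a x ×-dec inSide? e b y

  <suc⇒≤ : ∀ {a b} → a ℤ.< ℤ.suc b → a ℤ.≤ b
  <suc⇒≤ p = ℤ.≮⇒≥ λ b<a → ℤ.<⇒≱ p (ℤ.i<j⇒suc[i]≤j b<a)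

  eight : ℚ → ℚ
  eight e = let f = e + e in f + f + (f + f)

  -- `a ≤ x + e ≤ x′ + 4e ≤ a′ + 1 + 5e < a′ + 2`, because `8e ≤ 1`.
  side-order : ∀ {e a a′ x x′} → 0ℚ < e → eight e ≤ 1ℚ → InSide e a x → InSide e a′ x′ →
               Close (e + e + e) x x′ → a ℤ.≤ ℤ.suc a′
  side-order {e} {a} {a′} {x} {x′} e>0 e8≤1 (p , _) (_ , q′) (r , _) =
    <suc⇒≤ (fromℤ-cancel-< (subst (fromℤ a <_) (sym (fromℤ-suc (ℤ.suc a′)))
      (aux (fromℤ a) (fromℤ (ℤ.suc a′)) p q′ e8≤1)))
    where
    aux : ∀ u v → u ≤ x + e → x′ ≤ v + e → e + e + (e + e) + (e + e + (e + e)) ≤ 1ℚ → u < 1ℚ + v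
    aux u v p q h = lin< (e>0 ⊕< <⇒≤ e>0 ⊕< <⇒≤ e>0 ⊕< Δ h ⊕< Δ p ⊕< Δ q ⊕< Δ r)
      (solve (e ∷ u ∷ v ∷ x ∷ x′ ∷ []) ℚ-ring)

  shift : Bool → ℤ → ℤ
  shift false a = a
  shift true  a = ℤ.suc a

  four : ℚ → ℚ
  four e = e + e + (e + e)

  -- By `side-order`, distinct intervals are consecutive; then `x` is squeezed against their common
  -- end `shift σ a`.
  side-meet : ∀ {e a a′ x x′} → 0ℚ < e → eight e ≤ 1ℚ → InSide e a x → InSide e a′ x′ →
              Close (e + e + e) x x′ →
              a ≡ a′ ⊎ (ℤ.∣ a ℤ.- a′ ∣ ≡ 1 × ∃ λ σ → Close (four e) x (fromℤ (shift σ a)))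
  side-meet {e} {a} {a′} {x} {x′} e>0 e8≤1 s s′ c = compare (ℤ.<-cmp a a′)
    where
    widen : ∀ u v → u ≤ v + e → u ≤ v + (e + e + (e + e))
    widen u v p = lin (Δ p ⊕ <⇒≤ e>0 ⊕ <⇒≤ e>0 ⊕ <⇒≤ e>0) (solve (u ∷ v ∷ e ∷ []) ℚ-ring)
    far : ∀ u v w → u ≤ v + e → v ≤ w + (e + e + e) → u ≤ w + (e + e + (e + e))
    far u v w p q = lin (Δ p ⊕ Δ q) (solve (u ∷ v ∷ w ∷ e ∷ []) ℚ-ring)
    far′ : ∀ u v w → v ≤ u + e → w ≤ v + (e + e + e) → w ≤ u + (e + e + (e + e))
    far′ u v w p q = lin (Δ p ⊕ Δ q) (solve (u ∷ v ∷ w ∷ e ∷ []) ℚ-ring)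
    compare : _ → _
    compare (tri≈ _ a≡a′ _) = inj₁ a≡a′
    compare (tri< a<a′ _ _) = inj₂ (trans (cong (λ z → ℤ.∣ a ℤ.- z ∣) a′≡) (∣a-suc∣≡1 a) ,
      true , widen x (fromℤ (ℤ.suc a)) (InSide.right s) ,
      far (fromℤ (ℤ.suc a)) x′ x (subst (λ z → fromℤ z ≤ x′ + e) a′≡ (InSide.left s′)) (lower c))
      where a′≡ = ℤ.≤-antisym (side-order e>0 e8≤1 s′ s (close-sym c)) (ℤ.i<j⇒suc[i]≤j a<a′)
    compare (tri> _ _ a′<a) = inj₂ (trans (cong (λ z → ℤ.∣ z ℤ.- a′ ∣) a≡) (∣suc-a∣≡1 a′) ,
      false , far′ (fromℤ a) x′ x (subst (λ z → x′ ≤ fromℤ z + e) (sym a≡) (InSide.right s′)) (upper c) ,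
      widen (fromℤ a) x (InSide.left s))
      where a≡ = ℤ.≤-antisym (side-order e>0 e8≤1 s s′ c) (ℤ.i<j⇒suc[i]≤j a′<a)

  cornerOf : Square → Bool × Bool → ℚ × ℚ
  cornerOf (a , b) (σ , τ) = fromℤ (shift σ a) , fromℤ (shift τ b)

  data Close₂ (e : ℚ) : ℚ × ℚ → ℚ × ℚ → Set where
    _,_ : ∀ {x y x′ y′} → Close e x x′ → Close e y y′ → Close₂ e (x , y) (x′ , y′)

  -- Agreement in one coordinate would make the squares equal or adjacent. Hence they differ by one
  -- in both coordinates and meet in a corner only.
  box-meet : ∀ {e s s′ p p′} → 0ℚ < e → eight e ≤ 1ℚ → InBox e s p → InBox e s′ p′ →
             Close₂ (e + e + e) p p′ → s ≢ s′ → ¬ Adjacent s s′ →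
             ∃ λ στ → Close₂ (four e) p (cornerOf s στ)
  box-meet {e} {a , b} {a′ , b′} e>0 e8≤1 (i , j) (i′ , j′) (c , d) s≢s′ ¬adj
    with side-meet e>0 e8≤1 i i′ c | side-meet e>0 e8≤1 j j′ d
  ... | inj₁ refl          | inj₁ refl          = contradiction refl s≢s′
  ... | inj₁ refl          | inj₂ (∣b-b′∣≡1 , _) = contradiction (cong₂ ℕ._+_ (∣a-a∣≡0 a) ∣b-b′∣≡1) ¬adj
  ... | inj₂ (∣a-a′∣≡1 , _) | inj₁ refl          = contradiction (cong₂ ℕ._+_ ∣a-a′∣≡1 (∣a-a∣≡0 b)) ¬adj
  ... | inj₂ (_ , σ , p)   | inj₂ (_ , τ , q)   = (σ , τ) , p , q

  -- Rational points of the closed disk.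

  0≤x² : ∀ x → 0ℚ ≤ x * x
  0≤x² x with ℚ.≤-total 0ℚ x
  ... | inj₁ 0≤x = 0≤x ⊗ 0≤x
  ... | inj₂ x≤0 = lin (Δ x≤0 ⊗ Δ x≤0) (solve (x ∷ []) ℚ-ring)

  0≤ℕ : ∀ n → 0ℚ ≤ + n ℚ./ 1
  0≤ℕ n = ℚ.nonNegative⁻¹ (+ n ℚ./ 1) {{ℚ.normalize-nonNeg n 1}}

  -- Near the unit circle, a factor smaller than 1 by `16θ` gains about `32θ` in the squared norm.
  -- This covers the `4θ` by which a sample may violate the disk inequality, a horizontal shift of
  -- up to `θ`, and the further `θ * θ` allowed in the square of the ordinate.
  κ : ℚ → ℚ
  κ θ = 1ℚ - + 16 ℚ./ 1 * θ

  -- Shrinking makes up for (x, y), an approximation of a point of the disk, lying outside of it.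
  shrink-interior : ∀ θ x y → 0ℚ ≤ θ → + 32 ℚ./ 1 * θ ≤ 1ℚ → x * x + y * y ≤ 1ℚ + + 4 ℚ./ 1 * θ →
    ∀ τ v → 0ℚ ≤ τ → τ ≤ θ → v * v ≤ κ θ * y * (κ θ * y) + θ * θ →
    (κ θ * x + τ) * (κ θ * x + τ) + v * v ≤ 1ℚ
  shrink-interior θ x y 0≤θ 32θ≤1 x²+y²≤ τ v 0≤τ τ≤θ = unfolded
    where
    0≤κ : 0ℚ ≤ 1ℚ - + 16 ℚ./ 1 * θ
    0≤κ = lin (<⇒≤ 0<½ ⊕ <⇒≤ 0<½ ⊗ Δ 32θ≤1) (solve (θ ∷ []) ℚ-ring)
    unfolded : v * v ≤ (1ℚ - + 16 ℚ./ 1 * θ) * y * ((1ℚ - + 16 ℚ./ 1 * θ) * y) + θ * θ →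
               ((1ℚ - + 16 ℚ./ 1 * θ) * x + τ) * ((1ℚ - + 16 ℚ./ 1 * θ) * x + τ) + v * v ≤ 1ℚ
    unfolded v² =
      lin (Δ v² ⊕ 0≤κ ⊗ 0≤κ ⊗ Δ x²+y²≤ ⊕ 0≤κ ⊗ 0≤τ ⊗ (0≤x² (1ℚ - x) ⊕ 0≤x² y ⊕ Δ x²+y²≤)
           ⊕ Δ τ≤θ ⊗ (0≤ℕ 2 ⊕ 0≤ℕ 4 ⊗ 0≤θ) ⊕ 0≤ℕ 16 ⊗ 0≤θ ⊗ 0≤τ ⊗ (0≤ℕ 2 ⊕ 0≤ℕ 4 ⊗ 0≤θ)
           ⊕ Δ τ≤θ ⊗ (0≤θ ⊕ 0≤τ) ⊕ 0≤ℕ 20 ⊗ 0≤θ ⊕ 0≤ℕ 6 ⊗ 0≤θ ⊗ Δ 32θ≤1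
           ⊕ 0≤ℕ 26 ⊗ 0≤θ ⊗ 0≤θ ⊕ 0≤ℕ 32 ⊗ 0≤θ ⊗ 0≤θ ⊗ Δ 32θ≤1)
          (solve (θ ∷ x ∷ y ∷ τ ∷ v ∷ []) ℚ-ring)

  -- From `2|x| ≤ 1 + x²` one gets `|x| ≤ 2`, so that shrinking moves `x` by at most `32θ`; the
  -- shift `τ` adds at most `θ`.
  shrink-close : ∀ θ x y τ → + 32 ℚ./ 1 * θ ≤ 1ℚ → x * x + y * y ≤ 1ℚ + + 4 ℚ./ 1 * θ →
                 0ℚ ≤ θ → 0ℚ ≤ τ → τ ≤ θ →
                 Close (+ 33 ℚ./ 1 * θ) x ((1ℚ - + 16 ℚ./ 1 * θ) * x + τ)
  shrink-close θ x y τ p q 0≤θ 0≤τ τ≤θ =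
    lin (0≤ℕ 16 ⊗ 0≤θ ⊗ ½* (0≤x² (1ℚ - x) ⊕ slackness) ⊕ 0≤θ ⊕ 0≤τ) (solve (θ ∷ x ∷ y ∷ τ ∷ []) ℚ-ring) ,
    lin (0≤ℕ 16 ⊗ 0≤θ ⊗ ½* (0≤x² (1ℚ + x) ⊕ slackness) ⊕ Δ τ≤θ) (solve (θ ∷ x ∷ y ∷ τ ∷ []) ℚ-ring)
    where
    ½* : ∀ {z} → 0ℚ ≤ z → 0ℚ ≤ ½ * z
    ½* = <⇒≤ 0<½ ⊗_
    slackness = 0≤x² y ⊕ Δ q ⊕ ½* (½* (½* (Δ p))) ⊕ ℚ.nonNegative⁻¹ (+ 15 ℚ./ 8)

  near-ιₚ : ∀ {e p q} → Nearₚ e (ιₚ p) (ιₚ q) → Close₂ e p q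
  near-ιₚ (nearₚ p q) = near-ι p , near-ι q

  ιₚ-near : ∀ {e p q} → Close₂ e p q → Nearₚ e (ιₚ p) (ιₚ q)
  ιₚ-near (p , q) = nearₚ (ι-near p) (ι-near q)

  ⅛ : ℚ
  ⅛ = + 1 ℚ./ 8

  -- Convexity of the disk along axis-parallel lines: `t * t` is at most the square of the end
  -- towards which the sign of `t` points.
  square-between : ∀ {k l r t} → k + l * l ≤ 1ℚ → k + r * r ≤ 1ℚ → Between l r t → k + t * t ≤ 1ℚ
  square-between {k} {l} {r} {t} p q (l≤t , t≤r) with ℚ.≤-total 0ℚ t
  ... | inj₁ 0≤t =
    lin (Δ q ⊕ 0≤x² (r - t) ⊕ 0≤t ⊗ Δ t≤r ⊕ 0≤t ⊗ Δ t≤r) (solve (k ∷ r ∷ t ∷ []) ℚ-ring)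
  ... | inj₂ t≤0 =
    lin (Δ p ⊕ 0≤x² (t - l) ⊕ Δ t≤0 ⊗ Δ l≤t ⊕ Δ t≤0 ⊗ Δ l≤t) (solve (k ∷ l ∷ t ∷ []) ℚ-ring)

  close₂-refl : ∀ {p} → Close₂ 0ℚ p p
  close₂-refl = close-refl ≤-refl , close-refl ≤-refl

  centre : Square → ℚ × ℚ
  centre (a , b) = fromℤ a + ½ , fromℤ b + ½

  -- The two integers differ by at most `½ + ⅛ + 2e ≤ ⅞`.
  side-centre : ∀ {e a a′ x} → 0ℚ < e → eight e ≤ 1ℚ → InSide e a x → Close (e + ⅛) x (fromℤ a′ + ½) → a ≡ a′
  side-centre {e} {a} {a′} {x} e>0 e8≤1 (p , q) (r , s) = ℤ.≤-antisym
    (<suc⇒≤ (fromℤ-cancel-< (subst (fromℤ a <_) (sym (fromℤ-suc a′))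
      (lower-bound (fromℤ a) (fromℤ a′) p r e8≤1))))
    (<suc⇒≤ (fromℤ-cancel-< (subst (fromℤ a′ <_) (sym (fromℤ-suc a))
      (upper-bound (fromℤ a) (fromℤ a′) (subst (λ z → x ≤ z + e) (fromℤ-suc a) q) s e8≤1))))
    where
    0<⅛ : 0ℚ < ⅛
    0<⅛ = ℚ.positive⁻¹ ⅛
    0≤¼ : 0ℚ ≤ ½ * ½
    0≤¼ = <⇒≤ (0<½ ⊗< 0<½)
    lower-bound : ∀ u v → u ≤ x + e → x ≤ v + ½ + (e + ⅛) →
                  e + e + (e + e) + (e + e + (e + e)) ≤ 1ℚ → u < 1ℚ + v
    lower-bound u v p r h = lin< (0<⅛ ⊕< 0≤¼ ⊗ Δ h ⊕< Δ p ⊕< Δ r) (solve (e ∷ u ∷ v ∷ x ∷ []) ℚ-ring)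
    upper-bound : ∀ u v → x ≤ 1ℚ + u + e → v + ½ ≤ x + (e + ⅛) →
                  e + e + (e + e) + (e + e + (e + e)) ≤ 1ℚ → v < 1ℚ + u
    upper-bound u v p r h = lin< (0<⅛ ⊕< 0≤¼ ⊗ Δ h ⊕< Δ p ⊕< Δ r) (solve (e ∷ u ∷ v ∷ x ∷ []) ℚ-ring)

  box-centre : ∀ {e s s′ q} → 0ℚ < e → eight e ≤ 1ℚ → InBox e s q → Close₂ (e + ⅛) q (centre s′) → s ≡ s′
  box-centre e>0 e8≤1 (i , j) (p , q) = cong₂ _,_ (side-centre e>0 e8≤1 i p) (side-centre e>0 e8≤1 j q)

  -- Following the image of a curve in the disk.

  module Connectivity (D : Region) (H : IsQuadriculatedDisk D) where
    open Region D
    open Homeomorphic H renaming (to to g; from to h)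

    U = underlying D

    DiskPoint = Σ Point closedDisk

    image : DiskPoint → Point
    image z = proj₁ (h z)

    h-resp : ∀ {e z z′} → 0ℚ < e → Nearₚ 0ℚ (proj₁ z) (proj₁ z′) → Nearₚ e (image z) (image z′)
    h-resp {e} {z} {z′} e>0 z~z′ = let (d , d>0 , f) = from-continuous z e e>0 in
      within⇒nearₚ (f z′ (nearₚ⇒within (nearₚ-weaken (<⇒≤ d>0) z~z′)))

    -- The double negation in `underlying` cannot be removed for the real point itself, but
    -- searching the thickened squares for the rational point `q` is decidable, hence stable under
    -- double negation.
    locate : ∀ {e} → 0ℚ < e → (p : Σ Point U) →
             ∃₂ λ q i → Nearₚ e (proj₁ p) (ιₚ q) × InBox e (square i) q
    locate {e} e>0 ((x , y) , p∈U) =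
      let (q , x~q) = approx x e>0
          (r , y~r) = approx y e>0
          (i , box) = decidable-stable (Fin.any? (λ i → inBox? e (square i) (q , r)))
            (λ outside → p∈U λ (i , (l , u) , (l′ , u′)) →
              outside (i , (below x l x~q , above {fromℤ (ℤ.suc (proj₁ (square i)))} x u x~q) ,
                           (below y l′ y~r , above {fromℤ (ℤ.suc (proj₂ (square i)))} y u′ y~r)))
      in (q , r) , i , nearₚ x~q y~r , box

    corner : Fin size × Bool × Bool → ℚ × ℚ
    corner (i , στ) = cornerOf (square i) στ

    fromℤ-mono : ∀ a → fromℤ a ≤ fromℤ (ℤ.suc a)
    fromℤ-mono a = subst (fromℤ a ≤_) (sym (trans (fromℤ-suc a) (ℚ.+-comm 1ℚ (fromℤ a)))) (lin (<⇒≤ 0<1) refl)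

    const-≲ : ∀ {a b} → a ≤ b → const a ≲ const b
    const-≲ a≤b e e>0 = 0 , λ _ _ → ≤-trans a≤b (lin (<⇒≤ e>0) refl)

    shift-between : ∀ σ a → const (fromℤ a) ≲ const (fromℤ (shift σ a)) ×
                            const (fromℤ (shift σ a)) ≲ const (fromℤ (ℤ.suc a))
    shift-between false a = const-≲ ≤-refl , const-≲ (fromℤ-mono a)
    shift-between true  a = const-≲ (fromℤ-mono a) , const-≲ ≤-refl

    cornerPoint : Fin size × Bool × Bool → Σ Point U
    cornerPoint k@(i , σ , τ) = ιₚ (corner k) ,
      λ outside → outside (i , shift-between σ (proj₁ (square i)) , shift-between τ (proj₂ (square i)))

    bools : List Bool
    bools = false ∷ true ∷ []

    corners : List (Σ Point U)
    corners = map cornerPoint (cartesianProduct (allFin size) (cartesianProduct bools bools))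

    ∈-bools : ∀ b → b ∈ₗ bools
    ∈-bools false = here refl
    ∈-bools true  = there (here refl)

    ∈-corners : ∀ k → cornerPoint k ∈ₗ corners
    ∈-corners (i , σ , τ) = ∈-map⁺ cornerPoint
      (∈-cartesianProduct⁺ (∈-allFin i) (∈-cartesianProduct⁺ (∈-bools σ) (∈-bools τ)))

    -- Continuity of g at a point c turns a distance from g c into a distance of the image from c.
    separated : ∀ {μ} → 0ℚ < μ → (cs : List (Σ Point U)) → ∃ λ δ → 0ℚ < δ ×
                ∀ z → All (λ c → ¬ Nearₚ μ (proj₁ z) (proj₁ (g c))) cs →
                All (λ c → ¬ Nearₚ δ (image z) (proj₁ c)) cs
    separated μ>0 [] = 1ℚ , 0<1 , λ _ _ → All.[]
    separated {μ} μ>0 (c ∷ cs) =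
      let (δ , δ>0 , rest) = separated μ>0 cs
          (d , d>0 , f)    = to-continuous c (½ * μ) (half-pos μ>0)
          minimum {m} m>0 m≤δ m≤d = min-pos δ>0 d>0
      in m , m>0 , λ { z (away All.∷ aways) →
           (λ near-c → away (nearₚ-weaken half≤ (nearₚ-trans
              (nearₚ-sym (within⇒nearₚ {0ℚ} {proj₁ (g (h z))} {proj₁ z} (to∘from z)))
              (nearₚ-sym (within⇒nearₚ {½ * μ} (f (h z) (nearₚ⇒within (nearₚ-weaken m≤d (nearₚ-sym near-c)))))))))
           All.∷ All.map (_∘ nearₚ-weaken m≤δ) (rest z aways) }
      where
      half≤ : 0ℚ + ½ * μ ≤ μ
      half≤ = lin (<⇒≤ (half-pos μ>0)) (solve (μ ∷ []) ℚ-ring)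

    -- Every term of a parameter lies in `[l, r]`, so that membership in the disk can be checked
    -- term by term. `iso` says that the parametrisation does not increase distances.
    record Curve (l r : ℚ) : Set where
      field
        at  : (t : ℝ) → (∀ n → Between l r (seq t n)) → DiskPoint
        iso : ∀ {d t t′} p p′ → 0ℚ ≤ d → Near d t t′ → Nearₚ d (proj₁ (at t p)) (proj₁ (at t′ p′))

    diskPoint : (x y : ℝ) → (∀ n → seq x n * seq x n + seq y n * seq y n ≤ 1ℚ) → DiskPoint
    diskPoint x y f = (x , y) , λ e e>0 → 0 , λ n _ → ≤-trans (f n) (lin (<⇒≤ e>0) refl)

    ratPoint : ∀ x y → x * x + y * y ≤ 1ℚ → DiskPoint
    ratPoint x y p = diskPoint (ι x) (ι y) (λ _ → p)

    verticalCurve : ∀ {c l r} → c * c + l * l ≤ 1ℚ → c * c + r * r ≤ 1ℚ → Curve l r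
    verticalCurve {c} {l} {r} p q = record
      { at  = λ t t∈ → diskPoint (ι c) t (λ n → square-between {c * c} {l} {r} p q (t∈ n))
      ; iso = λ _ _ 0≤d t~t′ → nearₚ (near-refl 0≤d) t~t′
      }

    horizontalCurve : ∀ {c l r} → l * l + c * c ≤ 1ℚ → r * r + c * c ≤ 1ℚ → Curve l r
    horizontalCurve {c} {l} {r} p q = record
      { at  = λ t t∈ → diskPoint t (ι c) (λ n → subst (_≤ 1ℚ) (ℚ.+-comm (c * c) (seq t n * seq t n))
          (square-between {c * c} {l} {r} (subst (_≤ 1ℚ) (ℚ.+-comm (l * l) (c * c)) p)
                                          (subst (_≤ 1ℚ) (ℚ.+-comm (r * r) (c * c)) q) (t∈ n)))
      ; iso = λ _ _ 0≤d t~t′ → nearₚ t~t′ (near-refl 0≤d)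
      }

    module Scale {e δ : ℚ} (e>0 : 0ℚ < e) (e8≤1 : eight e ≤ 1ℚ) (e8≤δ : eight e ≤ δ) where

      Safe : DiskPoint → Set
      Safe z = ∀ k → ¬ Nearₚ δ (image z) (ιₚ (corner k))

      -- The choice depends on the representing Cauchy sequences, so equal points may receive
      -- different squares; `step` shows that at safe points this does not leave a union of
      -- components.
      cell : DiskPoint → Fin size
      cell z = proj₁ (proj₂ (locate e>0 (h z)))

      cell-centre : ∀ i z → Nearₚ ⅛ (image z) (ιₚ (centre (square i))) → cell z ≡ i
      cell-centre i z z~i = aux (locate e>0 (h z))
        where
        aux : (l : ∃₂ λ q j → Nearₚ e (image z) (ιₚ q) × InBox e (square j) q) → proj₁ (proj₂ l) ≡ i
        aux (q , j , z~q , box) = injective (box-centre e>0 e8≤1 box (near-ιₚ (nearₚ-trans (nearₚ-sym z~q) z~i)))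

      module _ {B : Pred (Fin size) 0ℓ} (B? : Decidable B)
               (closed : ∀ {i j} → B i → Adj D i j → B j) where

        -- Were `B` to change, the two squares would be neither equal nor adjacent, and `box-meet`
        -- would put the image of `z` within `e + 4e` of a corner. This contradicts `Safe z`, as
        -- `8e ≤ δ`.
        step : ∀ z z′ → Safe z → Nearₚ e (image z) (image z′) → B (cell z) → B (cell z′)
        step z z′ safe z~z′ Bz = decidable-stable (B? _) λ ¬Bz′ →
          let (q , i , z~q , box)     = locate e>0 (h z)
              (q′ , j , z′~q′ , box′) = locate e>0 (h z′)
              (στ , q~corner) = box-meet {s = square i} {square j} e>0 e8≤1 box box′
                (near-ιₚ (nearₚ-trans (nearₚ-trans (nearₚ-sym z~q) z~z′) z′~q′))
                (λ same → ¬Bz′ (subst B (injective same) Bz))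
                (λ adj → ¬Bz′ (closed Bz adj))
          in safe (i , στ) (nearₚ-weaken (≤-trans 5e≤8e e8≤δ) (nearₚ-trans z~q (ιₚ-near q~corner)))
          where
          5e≤8e : e + (e + e + (e + e)) ≤ e + e + (e + e) + (e + e + (e + e))
          5e≤8e = lin (<⇒≤ e>0 ⊕ <⇒≤ e>0 ⊕ <⇒≤ e>0) (solve (e ∷ []) ℚ-ring)

        pass : ∀ z za zb → Safe z → Safe za → Nearₚ e (image z) (image za) → Nearₚ e (image z) (image zb) →
               B (cell za) → B (cell zb)
        pass z za zb safe-z safe-za z~za z~zb Ba = step z zb safe-z z~zb (step za z safe-za (nearₚ-sym z~za) Ba)

        -- If `B` were lost between the ends, bisection would give a real parameter with rational
        -- parameters of both kinds close to it, and `pass` would carry `B` from one to the other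
        -- through that point.
        follow : ∀ {l r} (γ : Curve l r) → (∀ t t∈ → Safe (Curve.at γ t t∈)) → (l≤r : l ≤ r) →
                 B (cell (Curve.at γ (ι l) (λ _ → ≤-refl , l≤r))) →
                 B (cell (Curve.at γ (ι r) (λ _ → l≤r , ≤-refl)))
        follow {l} {r} γ safe l≤r Bl = decidable-stable (B? _) contradicts
          where
          open Curve γ
          BAt : ∀ {t} → Between l r t → Set
          BAt {t} t∈ = B (cell (at (ι t) (λ _ → t∈)))
          -- `BAt` takes a proof of membership in the interval as an argument. Such proofs are
          -- unique, so `Q` is decidable at every rational.
          Q : Pred ℚ 0ℓ
          Q t = Σ (Between l r t) BAt
          irrelevant : ∀ {t} (t∈ t∈′ : Between l r t) → BAt t∈′ → BAt t∈
          irrelevant (p , q) (p′ , q′) = subst BAt (cong₂ _,_ (ℚ.≤-irrelevant p′ p) (ℚ.≤-irrelevant q′ q))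
          Q? : Decidable Q
          Q? t = decide ((l ≤? t) ×-dec (t ≤? r))
            where
            decide : Dec (Between l r t) → Dec (Q t)
            decide (no ¬t∈) = no (¬t∈ ∘ proj₁)
            decide (yes t∈) = map′ (t∈ ,_) (λ (t∈′ , Bt) → irrelevant t∈ t∈′ Bt) (B? _)
          contradicts : ¬ BAt (l≤r , ≤-refl) → ⊥
          contradicts ¬Br = impossible (jump d>0)
            where
            ¬Qr : ¬ Q r
            ¬Qr (r∈ , Br) = ¬Br (irrelevant (l≤r , ≤-refl) r∈ Br)
            open Bisection {Q} Q? l≤r ((≤-refl , l≤r) , Bl) ¬Qr
            z : DiskPoint
            z = at limit lo-range
            cont = from-continuous z e e>0
            d = proj₁ cont
            d>0 : 0ℚ < d
            d>0 = proj₁ (proj₂ cont)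
            at-near : ∀ {t} t∈ → Near d limit (ι t) → Nearₚ e (image z) (image (at (ι t) (λ _ → t∈)))
            at-near t∈ lim~t = within⇒nearₚ {e}
              (proj₂ (proj₂ cont) _ (nearₚ⇒within (iso lo-range (λ _ → t∈) (<⇒≤ d>0) lim~t)))
            impossible : (∃₂ λ a b → Between l r a × Between l r b × Q a × ¬ Q b ×
                          Near d limit (ι a) × Near d limit (ι b)) → ⊥
            impossible (a , b , _ , b∈ , (a∈ , Ba) , ¬Qb , lim~a , lim~b) =
              ¬Qb (b∈ , pass z (at (ι a) (λ _ → a∈)) (at (ι b) (λ _ → b∈)) (safe _ _) (safe _ _)
                             (at-near a∈ lim~a) (at-near b∈ lim~b) Ba)

        move : ∀ {l r} (γ : Curve l r) → (∀ t t∈ → Safe (Curve.at γ t t∈)) → (l≤r : l ≤ r) →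
               ∀ z z′ → Safe z → Nearₚ 0ℚ (proj₁ z) (proj₁ (Curve.at γ (ι l) (λ _ → ≤-refl , l≤r))) →
               Nearₚ 0ℚ (proj₁ (Curve.at γ (ι r) (λ _ → l≤r , ≤-refl))) (proj₁ z′) →
               B (cell z) → B (cell z′)
        move γ safe l≤r z z′ safe-z z~l r~z′ Bz =
          step _ z′ (safe _ _) (h-resp e>0 r~z′) (follow γ safe l≤r (step z _ safe-z (h-resp e>0 z~l) Bz))

      module _ {B : Pred (Fin size) 0ℓ} (B? : Decidable B)
               (closed : ∀ {i j} → B i → Adj D i j → B j) where

        -- A curve is followed backwards by following it forwards with the complement of `B`, which
        -- is closed too because adjacency is symmetric.
        move⁻ : ∀ {l r} (γ : Curve l r) → (∀ t t∈ → Safe (Curve.at γ t t∈)) → (l≤r : l ≤ r) →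
                ∀ z z′ → Safe z′ → Nearₚ 0ℚ (proj₁ z′) (proj₁ (Curve.at γ (ι l) (λ _ → ≤-refl , l≤r))) →
                Nearₚ 0ℚ (proj₁ (Curve.at γ (ι r) (λ _ → l≤r , ≤-refl))) (proj₁ z) →
                B (cell z) → B (cell z′)
        move⁻ γ safe l≤r z z′ safe-z′ z′~l r~z Bz = decidable-stable (B? _) λ ¬Bz′ →
          move (¬? ∘ B?) (λ {i} {j} ¬Bi adj Bj → ¬Bi (closed Bj (adj-sym (square i) (square j) adj)))
            γ safe l≤r z′ z safe-z′ z′~l r~z ¬Bz′ Bz

        vertical : ∀ {c u v} (p : c * c + u * u ≤ 1ℚ) (q : c * c + v * v ≤ 1ℚ) →
                   (∀ z → proj₁ (proj₁ z) ≡ ι c → Safe z) →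
                   B (cell (ratPoint c u p)) → B (cell (ratPoint c v q))
        vertical {c} {u} {v} p q safe = [ ascending , descending ]′ (ℚ.≤-total u v)
          where
          ascending : u ≤ v → B (cell (ratPoint c u p)) → B (cell (ratPoint c v q))
          ascending u≤v = move B? closed (verticalCurve {c} {u} {v} p q) (λ _ _ → safe _ refl) u≤v
            (ratPoint c u p) (ratPoint c v q) (safe _ refl) (ιₚ-near close₂-refl) (ιₚ-near close₂-refl)
          descending : v ≤ u → B (cell (ratPoint c u p)) → B (cell (ratPoint c v q))
          descending v≤u = move⁻ (verticalCurve {c} {v} {u} q p) (λ _ _ → safe _ refl) v≤u
            (ratPoint c u p) (ratPoint c v q) (safe _ refl) (ιₚ-near close₂-refl) (ιₚ-near close₂-refl)

        horizontal : ∀ {c u v} (p : u * u + c * c ≤ 1ℚ) (q : v * v + c * c ≤ 1ℚ) →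
                     (∀ z → proj₂ (proj₁ z) ≡ ι c → Safe z) →
                     B (cell (ratPoint u c p)) → B (cell (ratPoint v c q))
        horizontal {c} {u} {v} p q safe = [ ascending , descending ]′ (ℚ.≤-total u v)
          where
          ascending : u ≤ v → B (cell (ratPoint u c p)) → B (cell (ratPoint v c q))
          ascending u≤v = move B? closed (horizontalCurve {c} {u} {v} p q) (λ _ _ → safe _ refl) u≤v
            (ratPoint u c p) (ratPoint v c q) (safe _ refl) (ιₚ-near close₂-refl) (ιₚ-near close₂-refl)
          descending : v ≤ u → B (cell (ratPoint u c p)) → B (cell (ratPoint v c q))
          descending v≤u = move⁻ (horizontalCurve {c} {v} {u} q p) (λ _ _ → safe _ refl) v≤u
            (ratPoint u c p) (ratPoint v c q) (safe _ refl) (ιₚ-near close₂-refl) (ιₚ-near close₂-refl)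

    -- One end of a route: the image of `(c, y)` lies near the centre of the square `i`, and the
    -- vertical line through `c` keeps away from the abscissae `xs` and meets the disk at every
    -- height in `[0, θ]`.
    record Reach (i : Fin size) (xs : List ℝ) : Set where
      field
        c y θ μ : ℚ
        θ>0     : 0ℚ < θ
        μ>0     : 0ℚ < μ
        start∈  : c * c + y * y ≤ 1ℚ
        base∈   : ∀ v → 0ℚ ≤ v → v ≤ θ → c * c + v * v ≤ 1ℚ
        avoids  : All (λ x → ¬ Near μ (ι c) x) xs
        arrives : Nearₚ ⅛ (image (ratPoint c y start∈)) (ιₚ (centre (square i)))

    centre-in : ∀ i → U (ιₚ (centre (square i)))
    centre-in i outside = outside (i , between-centre (proj₁ (square i)) , between-centre (proj₂ (square i)))
      where
      between-centre : ∀ a → const (fromℤ a) ≲ const (fromℤ a + ½) × const (fromℤ a + ½) ≲ const (fromℤ (ℤ.suc a))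
      between-centre a = const-≲ (lin (<⇒≤ 0<½) refl) ,
        const-≲ (subst (fromℤ a + ½ ≤_) (sym (fromℤ-suc a)) (upper-half (fromℤ a)))
        where
        upper-half : ∀ u → u + ½ ≤ 1ℚ + u
        upper-half u = lin (<⇒≤ 0<½) (solve (u ∷ []) ℚ-ring)

    record Sample (θ : ℚ) (z : DiskPoint) : Set where
      constructor sample
      field
        {x y} : ℚ
        x²+y² : x * x + y * y ≤ 1ℚ + + 4 ℚ./ 1 * θ
        close : Nearₚ θ (proj₁ z) (ιₚ (x , y))

    sampling : ∀ {θ} → 0ℚ < θ → ∀ z → Sample θ z
    sampling {θ} θ>0 ((x , y) , in-disk) =
      let (N , f) = in-disk (+ 4 ℚ./ 1 * θ) (ℚ.positive⁻¹ (+ 4 ℚ./ 1) ⊗< θ>0)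
          (K , k) = cauchy x θ θ>0
          (M , m) = cauchy y θ θ>0
          n = N ℕ.⊔ (K ℕ.⊔ M)
          K≤n = ℕ.≤-trans (ℕ.m≤m⊔n K M) (ℕ.m≤n⊔m N _)
          M≤n = ℕ.≤-trans (ℕ.m≤n⊔m K M) (ℕ.m≤n⊔m N _)
      in sample (f n (ℕ.m≤m⊔n N _))
           (nearₚ (close⇒near (K , λ j K≤j → abs⇒close (k j n K≤j K≤n)))
                  (close⇒near (M , λ j M≤j → abs⇒close (m j n M≤j M≤n))))

    construct : ∀ i xs → Reach i xs
    construct i xs = record
      { c = c ; y = κ θ * y ; θ = θ ; μ = Gap.margin interval ; θ>0 = θ>0 ; μ>0 = Gap.margin>0 interval
      ; start∈  = start∈
      ; base∈   = λ v 0≤v v≤θ → disk v (base-bound v 0≤v v≤θ)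
      ; avoids  = Gap.clear-left interval ≤-refl
      ; arrives = nearₚ-weaken (ℚ.≤-reflexive (ℚ.+-identityʳ ⅛)) (nearₚ-trans
          (nearₚ-sym (within⇒nearₚ {⅛} (continuous (ratPoint c (κ θ * y) start∈) (nearₚ⇒within close-start))))
          (within⇒nearₚ {0ℚ} {image z} {ιₚ (centre (square i))} (from∘to (ιₚ (centre (square i)) , centre-in i))))
      }
      where
      z : DiskPoint
      z = g (ιₚ (centre (square i)) , centre-in i)
      continuity = from-continuous z ⅛ (ℚ.positive⁻¹ ⅛)
      continuous = proj₂ (proj₂ continuity)
      open Minimum (min-pos (proj₁ (proj₂ continuity)) 0<1)
        renaming (value to d; positive to d>0; ≤ˡ to d≤; ≤ʳ to d≤1)
      -- Sampling moves `z` by at most `θ`, shrinking and shifting by at most `33 * θ`; the sum is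
      -- less than the modulus `d` of continuity. The bound `d ≤ 1` provides `32 * θ ≤ 1`.
      θ : ℚ
      θ = + 1 ℚ./ 64 * d
      θ>0 : 0ℚ < θ
      θ>0 = ℚ.positive⁻¹ (+ 1 ℚ./ 64) ⊗< d>0
      32θ≤1 : + 32 ℚ./ 1 * θ ≤ 1ℚ
      32θ≤1 = aux d (<⇒≤ d>0) d≤1
        where
        aux : ∀ d → 0ℚ ≤ d → d ≤ 1ℚ → + 32 ℚ./ 1 * (+ 1 ℚ./ 64 * d) ≤ 1ℚ
        aux d p q = lin (Δ q ⊕ <⇒≤ 0<½ ⊗ p) (solve (d ∷ []) ℚ-ring)
      open Sample (sampling θ>0 z)
      -- The abscissa is not `κ θ * x` itself but a nearby `c` in this interval that avoids `xs`;
      -- the shift `τ` is at most `θ`.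
      interval : Gap (κ θ * x) (κ θ * x + θ) xs
      interval = avoid xs (lin< θ>0 refl)
      c = Gap.left interval
      τ = c - κ θ * x
      0≤τ : 0ℚ ≤ τ
      0≤τ = Δ (Gap.l≤left interval)
      τ≤θ : τ ≤ θ
      τ≤θ = aux c (κ θ * x) θ (≤-trans (<⇒≤ (Gap.left<right interval)) (Gap.right≤r interval))
        where
        aux : ∀ c u θ → c ≤ u + θ → c - u ≤ θ
        aux c u θ p = lin (Δ p) (solve (c ∷ u ∷ θ ∷ []) ℚ-ring)
      disk : ∀ v → v * v ≤ κ θ * y * (κ θ * y) + θ * θ → c * c + v * v ≤ 1ℚ
      disk v v² = subst (λ c → c * c + v * v ≤ 1ℚ) (l+[r-l]≡r (κ θ * x) c)
        (shrink-interior θ x y (<⇒≤ θ>0) 32θ≤1 x²+y² τ v 0≤τ τ≤θ v²)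
      start∈ : c * c + κ θ * y * (κ θ * y) ≤ 1ℚ
      start∈ = disk (κ θ * y) (lin (0≤x² θ) refl)
      base-bound : ∀ v → 0ℚ ≤ v → v ≤ θ → v * v ≤ κ θ * y * (κ θ * y) + θ * θ
      base-bound v 0≤v v≤θ = aux (κ θ * y) θ v≤θ
        where
        aux : ∀ w θ → v ≤ θ → v * v ≤ w * w + θ * θ
        aux w θ v≤θ = lin (0≤x² w ⊕ 0≤x² (θ - v) ⊕ 0≤v ⊗ Δ v≤θ ⊕ 0≤v ⊗ Δ v≤θ)
          (solve (v ∷ w ∷ θ ∷ []) ℚ-ring)
      close-x : Close (+ 33 ℚ./ 1 * θ) x c
      close-x = subst (Close (+ 33 ℚ./ 1 * θ) x) (l+[r-l]≡r (κ θ * x) c)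
        (shrink-close θ x y τ 32θ≤1 x²+y² (<⇒≤ θ>0) 0≤τ τ≤θ)
      close-y : Close (+ 33 ℚ./ 1 * θ) y (κ θ * y)
      close-y = subst (Close (+ 33 ℚ./ 1 * θ) y) (ℚ.+-identityʳ (κ θ * y))
        (shrink-close θ y x 0ℚ 32θ≤1 (subst (_≤ 1ℚ + + 4 ℚ./ 1 * θ) (ℚ.+-comm (x * x) (y * y)) x²+y²)
          (<⇒≤ θ>0) ≤-refl (<⇒≤ θ>0))
      close-start : Nearₚ (proj₁ continuity) (proj₁ z) (ιₚ (c , κ θ * y))
      close-start = nearₚ-weaken (≤-trans (aux d (<⇒≤ d>0)) d≤) (nearₚ-trans close (ιₚ-near (close-x , close-y)))
        where
        aux : ∀ d → 0ℚ ≤ d → + 1 ℚ./ 64 * d + + 33 ℚ./ 1 * (+ 1 ℚ./ 64 * d) ≤ d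
        aux d p = lin (ℚ.nonNegative⁻¹ (+ 15 ℚ./ 32) ⊗ p) (solve (d ∷ []) ℚ-ring)

    abstract
      reach : ∀ i xs → Reach i xs
      reach = construct

    separations : (Point → ℝ) → List ℝ
    separations coordinate = map (coordinate ∘ proj₁ ∘ g) corners

    -- Three segments: vertical from the end at `i` to the height `v`, horizontal at that height,
    -- vertical to the end at `j`. The lines keep the distance `μ` from the abscissae, respectively
    -- ordinates, of the preimages of the corners.
    record Route (i j : Fin size) : Set where
      field
        start : Reach i (separations proj₁)
        end   : Reach j (separations proj₁)
        v μ   : ℚ
        0≤v   : 0ℚ ≤ v
        v≤θ₁  : v ≤ Reach.θ start
        v≤θ₂  : v ≤ Reach.θ end
        μ>0   : 0ℚ < μ
        away₁ : All (λ x → ¬ Near μ (ι (Reach.c start)) x) (separations proj₁)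
        away₂ : All (λ x → ¬ Near μ (ι (Reach.c end)) x) (separations proj₁)
        away  : All (λ y → ¬ Near μ (ι v) y) (separations proj₂)

    route : ∀ i j → Route i j
    route i j = via (min-pos I.θ>0 J.θ>0) (min-pos I.μ>0 J.μ>0)
      where
      module I = Reach (reach i (separations proj₁))
      module J = Reach (reach j (separations proj₁))
      assemble : ∀ {θ μ′} → θ ≤ I.θ → θ ≤ J.θ → μ′ ≤ I.μ → μ′ ≤ J.μ →
                 (γ : Gap 0ℚ θ (separations proj₂)) → Minimum (Gap.margin γ) μ′ → Route i j
      assemble θ≤I θ≤J μ′≤I μ′≤J γ (minimum {m} m>0 m≤μ m≤μ′) = record
        { start = reach i _ ; end = reach j _ ; v = Gap.left γ ; μ = m ; 0≤v = Gap.l≤left γ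
        ; v≤θ₁ = ≤-trans v≤θ θ≤I ; v≤θ₂ = ≤-trans v≤θ θ≤J ; μ>0 = m>0
        ; away₁ = All.map (_∘ near-weaken (≤-trans m≤μ′ μ′≤I)) I.avoids
        ; away₂ = All.map (_∘ near-weaken (≤-trans m≤μ′ μ′≤J)) J.avoids
        ; away  = Gap.clear-left γ m≤μ
        }
        where v≤θ = ≤-trans (<⇒≤ (Gap.left<right γ)) (Gap.right≤r γ)
      via : Minimum I.θ J.θ → Minimum I.μ J.μ → Route i j
      via (minimum θ>0 θ≤I θ≤J) (minimum μ′>0 μ′≤I μ′≤J) =
        assemble θ≤I θ≤J μ′≤I μ′≤J γ (min-pos (Gap.margin>0 γ) μ′>0)
        where γ = avoid (separations proj₂) θ>0

    module _ {A : Pred (Fin size) 0ℓ} (A? : Decidable A) (closed : ∀ {i j} → A i → Adj D i j → A j) where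

      travel : ∀ {i j e δ} (R : Route i j) → 0ℚ < e → eight e ≤ 1ℚ → eight e ≤ δ →
               (∀ z → All (λ c → ¬ Nearₚ (Route.μ R) (proj₁ z) (proj₁ (g c))) corners →
                      All (λ c → ¬ Nearₚ δ (image z) (proj₁ c)) corners) →
               A i → A j
      travel {i} {j} {e} {δ} R e>0 e8≤1 e8≤δ separate Ai =
        subst A (cell-centre j (ratPoint J.c J.y J.start∈) J.arrives)
          (vertical A? closed {J.c} {v} {J.y} (J.base∈ v 0≤v v≤θ₂) J.start∈ (safe₁ away₂)
            (horizontal A? closed {v} {I.c} {J.c} (I.base∈ v 0≤v v≤θ₁) (J.base∈ v 0≤v v≤θ₂) (safe₂ away)
              (vertical A? closed {I.c} {I.y} {v} I.start∈ (I.base∈ v 0≤v v≤θ₁) (safe₁ away₁)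
                (subst A (sym (cell-centre i (ratPoint I.c I.y I.start∈) I.arrives)) Ai))))
        where
        open Route R
        module I = Reach start
        module J = Reach end
        open Scale {e} {δ} e>0 e8≤1 e8≤δ
        safe : ∀ z → All (λ c → ¬ Nearₚ μ (proj₁ z) (proj₁ (g c))) corners → Safe z
        safe z all k = All.lookup (separate z all) (∈-corners k)
        -- Distance in a single coordinate suffices in the maximum norm, so one line is safe along
        -- its whole length.
        safe₁ : ∀ {c} → All (λ x → ¬ Near μ (ι c) x) (separations proj₁) →
                ∀ z → proj₁ (proj₁ z) ≡ ι c → Safe z
        safe₁ all z eq = safe z
          (All.map (λ far c~z → far (subst (λ x → Near μ x _) eq (near₁ c~z))) (All.map⁻ all))
        safe₂ : ∀ {c} → All (λ y → ¬ Near μ (ι c) y) (separations proj₂) →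
                ∀ z → proj₂ (proj₁ z) ≡ ι c → Safe z
        safe₂ all z eq = safe z
          (All.map (λ far c~z → far (subst (λ x → Near μ x _) eq (near₂ c~z))) (All.map⁻ all))

      -- The order of choices matters: the margin `μ` of the route determines the distance `δ` of
      -- its image from the corners, and only then is the scale fixed as an eighth of the minimum of
      -- `δ` and 1.
      connected : ∀ {i j} → A i → A j
      connected {i} {j} Ai = scale (separated μ>0 corners)
        where
        R : Route i j
        R = route i j
        open Route R using (μ; μ>0)
        8e≡ : ∀ m → let e = + 1 ℚ./ 8 * m in e + e + (e + e) + (e + e + (e + e)) ≡ m
        8e≡ m = solve (m ∷ []) ℚ-ring
        scale : (∃ λ δ → 0ℚ < δ × ∀ z → All (λ c → ¬ Nearₚ μ (proj₁ z) (proj₁ (g c))) corners →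
                 All (λ c → ¬ Nearₚ δ (image z) (proj₁ c)) corners) → A j
        scale (δ , δ>0 , separate) = rescale (min-pos δ>0 0<1)
          where
          rescale : Minimum δ 1ℚ → A j
          rescale (minimum {m} m>0 m≤δ m≤1) = travel R (ℚ.positive⁻¹ ⅛ ⊗< m>0)
            (subst (_≤ 1ℚ) (sym (8e≡ m)) m≤1) (subst (_≤ δ) (sym (8e≡ m)) m≤δ) separate Ai


open import Algebra.Properties.CommutativeMonoid.Sum ℤ.+-0-commutativeMonoid
  using (sum; sum-cong-≗; ∑-distrib-+; sum-permute; sum-replicate-zero)
open GroupProperties (AbelianGroup.group ℤ.+-0-abelianGroup) using (identityʳ-unique; ∙-cancelʳ; ∙-cancelˡ)
open import Data.Fin.Subset
  using (Subset; ⊤; ⊥; ∁; ⁅_⁆; _∈_; _∉_; _⊆_; _∪_; _∩_; Empty; Nonempty)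
  renaming (∣_∣ to card)
open import Data.Fin.Subset.Properties
  using (x∈p∪q⁻; x∈p∪q⁺; x∈∁p⇒x∉p; x∉p⇒x∈∁p; _∈?_; x∈⁅x⁆; x∈⁅y⁆⇒x≡y; x∈p∩q⁺; x∈p∩q⁻; ∉⊥; ∈⊤;
         ⊆-antisym; nonempty?; p⊆q⇒∣p∣≤∣q∣; p⊂q⇒∣p∣<∣q∣; ∣⁅x⁆∣≡1; ∣⊤∣≡n; ∪-idempotentCommutativeMonoid)
open import Data.Nat.Base using (zero; suc; _+_; _≤_; s≤s; z≤n)

-- Weighted sums over sets of squares

∈⇒true : ∀ {n} {r : Subset n} {i} → i ∈ r → lookup r i ≡ true
∈⇒true = []=⇒lookup

true⇒∈ : ∀ {n} {r : Subset n} {i} → lookup r i ≡ true → i ∈ r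
true⇒∈ = lookup⇒[]= _ _

∉⇒false : ∀ {n} {r : Subset n} {i} → i ∉ r → lookup r i ≡ false
∉⇒false {r = r} {i} i∉r with lookup r i in eq
... | false = refl
... | true  = contradiction (true⇒∈ eq) i∉r

false⇒∉ : ∀ {n} {r : Subset n} {i} → lookup r i ≡ false → i ∉ r
false⇒∉ eq i∈r with trans (sym eq) (∈⇒true i∈r)
... | ()

module _ {n : ℕ} where

  restrict : (Fin n → ℤ) → Subset n → Fin n → ℤ
  restrict w r i = if lookup r i then w i else 0ℤ

  total : (Fin n → ℤ) → Subset n → ℤ
  total w r = sum (restrict w r)

  total-∪ : ∀ w (p q : Subset n) → (∀ i → i ∈ p → i ∉ q) → total w (p ∪ q) ≡ total w p ℤ.+ total w q
  total-∪ w p q disjoint = trans (sum-cong-≗ pointwise) (∑-distrib-+ (restrict w p) (restrict w q))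
    where
    pointwise : ∀ i → restrict w (p ∪ q) i ≡ restrict w p i ℤ.+ restrict w q i
    pointwise i rewrite lookup-zipWith _∨_ i p q with lookup p i in i∈p | lookup q i in i∈q
    ... | true  | true  = contradiction (true⇒∈ i∈q) (disjoint i (true⇒∈ i∈p))
    ... | true  | false = sym (ℤ.+-identityʳ (w i))
    ... | false | true  = sym (ℤ.+-identityˡ (w i))
    ... | false | false = refl

  total-∁ : ∀ w (p : Subset n) → total w p ℤ.+ total w (∁ p) ≡ total w ⊤
  total-∁ w p = trans (sym (∑-distrib-+ (restrict w p) (restrict w (∁ p)))) (sum-cong-≗ pointwise)
    where
    pointwise : ∀ i → restrict w p i ℤ.+ restrict w (∁ p) i ≡ restrict w ⊤ i
    pointwise i rewrite lookup-map i not p | lookup-replicate {n = n} i true with lookup p i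
    ... | true  = ℤ.+-identityʳ (w i)
    ... | false = ℤ.+-identityˡ (w i)

  total-⊥ : ∀ w → total w ⊥ ≡ 0ℤ
  total-⊥ w = trans (sum-cong-≗ pointwise) (sum-replicate-zero n)
    where
    pointwise : ∀ i → restrict w ⊥ i ≡ 0ℤ
    pointwise i rewrite lookup-replicate {n = n} i false = refl

  double-zero : ∀ x → x ℤ.+ x ≡ 0ℤ → x ≡ 0ℤ
  double-zero (+ zero) _ = refl

  -- Reindexing by `m` preserves the sum, so twice the sum is a sum of terms `f i + f (m i)`, all of
  -- which vanish.
  total-involution : ∀ w (r : Subset n) (m : Fin n → Fin n) → (∀ i → i ∈ r → m i ∈ r) →
                     (∀ i → m (m i) ≡ i) → (∀ i → i ∈ r → w i ℤ.+ w (m i) ≡ 0ℤ) → total w r ≡ 0ℤ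
  total-involution w r m closed involutive cancels = double-zero _ (begin
    total w r ℤ.+ total w r                ≡⟨ cong (ℤ._+_ (total w r)) (sum-permute f π) ⟩
    total w r ℤ.+ sum (λ i → f (m i))      ≡⟨ ∑-distrib-+ f (f ∘ m) ⟨
    sum (λ i → f i ℤ.+ f (m i))            ≡⟨ sum-cong-≗ pointwise ⟩
    sum {n} (λ _ → 0ℤ)                     ≡⟨ sum-replicate-zero n ⟩
    0ℤ                                     ∎)
    where
    open ≡-Reasoning
    f : Fin n → ℤ
    f = restrict w r
    π = permutation m m involutive involutive
    pointwise : ∀ i → f i ℤ.+ f (m i) ≡ 0ℤ
    pointwise i with lookup r i in i∈r | lookup r (m i) in mi∈r
    ... | true  | true  = cancels i (true⇒∈ i∈r)
    ... | true  | false = contradiction (closed i (true⇒∈ i∈r)) (false⇒∉ mi∈r)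
    ... | false | true  = contradiction (subst (_∈ r) (involutive i) (closed (m i) (true⇒∈ mi∈r))) (false⇒∉ i∈r)
    ... | false | false = refl

total-⁅⁆ : ∀ {n} w (i : Fin n) → total w ⁅ i ⁆ ≡ w i
total-⁅⁆ {suc n} w zero    = trans (cong (ℤ._+_ (w zero)) (total-⊥ {n} (w ∘ suc))) (ℤ.+-identityʳ (w zero))
total-⁅⁆ {suc n} w (suc i) = trans (ℤ.+-identityˡ (total {n} (w ∘ suc) ⁅ i ⁆)) (total-⁅⁆ (w ∘ suc) i)

sign : Bool → ℤ
sign b = if b then 1ℤ else -1ℤ

-- Turns the comparison of two cardinalities in `Balanced` into the vanishing of an integer sum, to
-- which the lemmas on `total` apply.
card-difference : ∀ {n} (r c : Subset n) →
  + card (r ∩ c) ≡ + card (r ∩ ∁ c) ℤ.+ total (λ i → sign (lookup c i)) r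
card-difference Vec.[] Vec.[] = refl
card-difference (b Vec.∷ r) (c Vec.∷ cs) = extend b c (card-difference r cs)
  where
  extend : ∀ b c {t} → + card (r ∩ cs) ≡ + card (r ∩ ∁ cs) ℤ.+ t →
           + card ((b Vec.∷ r) ∩ (c Vec.∷ cs)) ≡
           + card ((b Vec.∷ r) ∩ ∁ (c Vec.∷ cs)) ℤ.+ ((if b then sign c else 0ℤ) ℤ.+ t)
  extend true true {t} ih = trans (cong (ℤ._+_ 1ℤ) ih) (rearrange (+ card (r ∩ ∁ cs)) t)
    where
    rearrange : ∀ a t → 1ℤ ℤ.+ (a ℤ.+ t) ≡ a ℤ.+ (1ℤ ℤ.+ t)
    rearrange a t = solve (a ∷ t ∷ []) ℤ-ring
  extend true false {t} ih = trans ih (rearrange (+ card (r ∩ ∁ cs)) t)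
    where
    rearrange : ∀ a t → a ℤ.+ t ≡ (1ℤ ℤ.+ a) ℤ.+ (-1ℤ ℤ.+ t)
    rearrange a t = solve (a ∷ t ∷ []) ℤ-ring
  extend false _ {t} ih = trans ih (cong (ℤ._+_ (+ card (r ∩ ∁ cs))) (sym (ℤ.+-identityˡ t)))

-- Colours of adjacent squares.

parity-suc : ∀ z → parity ℤ.∣ ℤ.suc z ∣ ≡ parity ℤ.∣ z ∣ ℙ.⁻¹
parity-suc (+ n) = sym (trans (cong ℙ._⁻¹ (sym (ℙ.suc-homo-⁻¹ n))) (ℙ.⁻¹-involutive _))
parity-suc -[1+ zero ] = refl
parity-suc -[1+ suc n ] = sym (ℙ.suc-homo-⁻¹ (suc n))

∣i∣≡1 : ∀ i → ℤ.∣ i ∣ ≡ 1 → i ≡ 1ℤ ⊎ i ≡ -1ℤ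
∣i∣≡1 (+ 1)    refl = inj₁ refl
∣i∣≡1 -[1+ 0 ] refl = inj₂ refl

m+n≡1 : ∀ m n → m ℕ.+ n ≡ 1 → (m ≡ 1 × n ≡ 0) ⊎ (m ≡ 0 × n ≡ 1)
m+n≡1 0 1 refl = inj₂ (refl , refl)
m+n≡1 1 0 refl = inj₁ (refl , refl)

parity-step : ∀ x y → x ℤ.- y ≡ 1ℤ ⊎ x ℤ.- y ≡ -1ℤ → parity ℤ.∣ x ∣ ≡ parity ℤ.∣ y ∣ ℙ.⁻¹
parity-step x y (inj₁ eq) = trans (cong (parity ∘ ℤ.∣_∣) (trans (cancel x y) (cong (ℤ._+ y) eq))) (parity-suc y)
  where
  cancel : ∀ x y → x ≡ x ℤ.- y ℤ.+ y
  cancel x y = solve (x ∷ y ∷ []) ℤ-ring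
parity-step x y (inj₂ eq) = trans (sym (ℙ.⁻¹-involutive _))
  (cong ℙ._⁻¹ (trans (sym (parity-suc x)) (cong (parity ∘ ℤ.∣_∣)
    (trans (cancel x y) (trans (cong (λ d → 1ℤ ℤ.+ d ℤ.+ y) eq) (ℤ.+-identityˡ y))))))
  where
  cancel : ∀ x y → 1ℤ ℤ.+ x ≡ 1ℤ ℤ.+ (x ℤ.- y) ℤ.+ y
  cancel x y = solve (x ∷ y ∷ []) ℤ-ring

difference : ∀ a b a′ b′ → (a ℤ.+ b) ℤ.- (a′ ℤ.+ b′) ≡ (a ℤ.- a′) ℤ.+ (b ℤ.- b′)
difference a b a′ b′ = solve (a ∷ b ∷ a′ ∷ b′ ∷ []) ℤ-ring

adjacent⇒color : ∀ p q → Adjacent p q → color p ≡ color q ℙ.⁻¹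
adjacent⇒color (a , b) (a′ , b′) adj = parity-step (a ℤ.+ b) (a′ ℤ.+ b′)
  (subst (λ d → d ≡ 1ℤ ⊎ d ≡ -1ℤ) (sym (difference a b a′ b′)) (unit (m+n≡1 _ _ adj)))
  where
  x = a ℤ.- a′
  y = b ℤ.- b′
  unit : (ℤ.∣ x ∣ ≡ 1 × ℤ.∣ y ∣ ≡ 0) ⊎ (ℤ.∣ x ∣ ≡ 0 × ℤ.∣ y ∣ ≡ 1) → x ℤ.+ y ≡ 1ℤ ⊎ x ℤ.+ y ≡ -1ℤ
  unit (inj₁ (p , q)) rewrite ℤ.∣i∣≡0⇒i≡0 {y} q | ℤ.+-identityʳ x = ∣i∣≡1 x p
  unit (inj₂ (p , q)) rewrite ℤ.∣i∣≡0⇒i≡0 {x} p | ℤ.+-identityˡ y = ∣i∣≡1 y q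

module Colours (D : Region) where
  open Region D

  adj⇒≢ : ∀ {i j} → Adj D i j → i ≢ j
  adj⇒≢ {i} adj refl = ℙ.p≢p⁻¹ _ (adjacent⇒color (square i) (square i) adj)

  charge : Fin size → ℤ
  charge i = sign (lookup (whites D) i)

  adj⇒charge : ∀ {i j} → Adj D i j → charge i ℤ.+ charge j ≡ 0ℤ
  adj⇒charge {i} {j} adj
    rewrite lookup∘tabulate (λ k → does (color (square k) ℙ.≟ white)) i
          | lookup∘tabulate (λ k → does (color (square k) ℙ.≟ white)) j
          | adjacent⇒color (square i) (square j) adj
    with color (square j)
  ... | 0ℙ = refl
  ... | 1ℙ = refl

  balanced⇒total : ∀ r → Balanced D r → total charge r ≡ 0ℤ
  balanced⇒total r b = identityʳ-unique (+ card (r ∩ ∁ (whites D))) _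
    (trans (sym (card-difference r (whites D))) (cong +_ b))

  total⇒balanced : ∀ r → total charge r ≡ 0ℤ → Balanced D r
  total⇒balanced r t = ℤ.+-injective (trans (card-difference r (whites D))
    (trans (cong (ℤ._+_ (+ card (r ∩ ∁ (whites D)))) t) (ℤ.+-identityʳ _)))

-- Homomorphisms from the even domino group

module _ (D : Region) where
  open Region D
  open Colours D

  lookup-addDomino-other : ∀ {i j x} (m : Mates D) → x ≢ i → x ≢ j → lookup (addDomino D i j m) x ≡ lookup m x
  lookup-addDomino-other {i} {j} m x≢i x≢j = trans (lookup∘update′ x≢j (m [ i ]≔ j) i) (lookup∘update′ x≢i m j)

  lookup-addDomino-snd : ∀ {i j} (m : Mates D) → lookup (addDomino D i j m) j ≡ i
  lookup-addDomino-snd {i} {j} m = lookup∘update j (m [ i ]≔ j) i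

  lookup-addDomino-fst : ∀ {i j} (m : Mates D) → i ≢ j → lookup (addDomino D i j m) i ≡ j
  lookup-addDomino-fst {i} {j} m i≢j = trans (lookup∘update′ i≢j (m [ i ]≔ j) i) (lookup∘update i m j)

  total-pair : ∀ (v : Fin size → ℤ) {i j} → i ≢ j → total v (⁅ i ⁆ ∪ ⁅ j ⁆) ≡ v i ℤ.+ v j
  total-pair v {i} {j} i≢j = trans
    (total-∪ v ⁅ i ⁆ ⁅ j ⁆ (λ k k∈i k∈j → i≢j (trans (sym (x∈⁅y⁆⇒x≡y i k∈i)) (x∈⁅y⁆⇒x≡y j k∈j))))
    (cong₂ ℤ._+_ (total-⁅⁆ v i) (total-⁅⁆ v j))

  total-domino : ∀ (v : Fin size → ℤ) {i j p q} → i ≢ j → v i ℤ.+ v j ≡ 0ℤ → i ∉ p → j ∉ p →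
                 q ≡ p ∪ (⁅ i ⁆ ∪ ⁅ j ⁆) → total v q ≡ total v p
  total-domino v {i} {j} {p} i≢j vi+vj i∉p j∉p refl = trans (total-∪ v p (⁅ i ⁆ ∪ ⁅ j ⁆) apart)
    (trans (cong (ℤ._+_ (total v p)) (trans (total-pair v i≢j) vi+vj)) (ℤ.+-identityʳ _))
    where
    apart : ∀ k → k ∈ p → k ∉ ⁅ i ⁆ ∪ ⁅ j ⁆
    apart k k∈p k∈ with x∈p∪q⁻ ⁅ i ⁆ ⁅ j ⁆ k∈
    ... | inj₁ k∈i = i∉p (subst (_∈ p) (x∈⁅y⁆⇒x≡y i k∈i) k∈p)
    ... | inj₂ k∈j = j∉p (subst (_∈ p) (x∈⁅y⁆⇒x≡y j k∈j) k∈p)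

  module Labelling
    (s : Fin size) (w : Fin size → ℤ) (w-anti : ∀ {i j} → Adj D i j → i ≢ s → j ≢ s → w i ℤ.+ w j ≡ 0ℤ)
    (T : Subset size) (s∉T : s ∉ T)
    (T-closed : ∀ {i j} → Adj D i j → i ≢ s → j ≢ s → lookup T i ≡ lookup T j)
    (G : Group 0ℓ 0ℓ) (label : ℤ → Group.Carrier G) where

    open Group G renaming (ε to 1#; refl to ≈-refl; sym to ≈-sym; trans to ≈-trans; reflexive to ≈-reflexive)
    open GroupProperties G using (\\-leftDividesˡ; \\-leftDividesʳ; ε⁻¹≈ε; inverseˡ-unique)

    weigh : ℤ → Bool → Carrier
    weigh x b = if b then label x else 1#

    towardsT : ∀ {p q} → Edge D p q → Bool
    towardsT f = lookup T (lookup (mates f) s)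

    -- The parity is that of the position of the edge in its path. An edge and its reversal in
    -- consecutive positions read the weight at the same plug with opposite exponents, so
    -- backtracking cancels.
    value : ∀ {p q} → Parity → Edge D p q → Carrier
    value {p} {q} 0ℙ f = weigh (total w (cells p)) (towardsT f)
    value {p} {q} 1ℙ f = weigh (total w (cells q)) (towardsT f) ⁻¹

    φ : ∀ {p q} → Parity → Path D p q → Carrier
    φ π ε       = 1#
    φ π (f ◅ α) = value π f ∙ φ (π ℙ.⁻¹) α

    parity-shift : ∀ π n → π ℙ.⁻¹ ℙ.+ parity n ≡ π ℙ.+ parity (suc n)
    parity-shift π n = trans (shift π (parity n))
      (cong (π ℙ.+_) (trans (cong ℙ._⁻¹ (sym (ℙ.suc-homo-⁻¹ n))) (ℙ.⁻¹-involutive _)))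
      where
      shift : ∀ π ρ → π ℙ.⁻¹ ℙ.+ ρ ≡ π ℙ.+ ρ ℙ.⁻¹
      shift 0ℙ ρ = refl
      shift 1ℙ ρ = sym (ℙ.⁻¹-involutive ρ)

    length-◅◅ : ∀ {p q r} (α : Path D p q) (β : Path D q r) →
                lengthParity D (α ◅◅ β) ≡ lengthParity D α ℙ.+ lengthParity D β
    length-◅◅ ε β = refl
    length-◅◅ (f ◅ α) β = trans (sym (parity-shift 0ℙ (length D (α ◅◅ β))))
      (trans (cong (1ℙ ℙ.+_) (length-◅◅ α β)) (trans (sym (ℙ.+-assoc 1ℙ (lengthParity D α) (lengthParity D β)))
        (cong (ℙ._+ lengthParity D β) (parity-shift 0ℙ (length D α)))))

    φ-◅◅ : ∀ {p q r} π (α : Path D p q) (β : Path D q r) →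
           φ π (α ◅◅ β) ≈ φ π α ∙ φ (π ℙ.+ lengthParity D α) β
    φ-◅◅ π ε β = ≈-trans (≈-reflexive (cong (λ ρ → φ ρ β) (sym (ℙ.+-identityʳ π)))) (≈-sym (identityˡ _))
    φ-◅◅ π (f ◅ α) β = ≈-trans (∙-congˡ (φ-◅◅ (π ℙ.⁻¹) α β)) (≈-trans (≈-sym (assoc _ _ _))
      (∙-congˡ (≈-reflexive (cong (λ ρ → φ ρ β) (parity-shift π (length D α))))))

    unmatched : ∀ {p q} (f : Edge D p q) → s ∈ cells p ⊎ s ∈ cells q → towardsT f ≡ false
    unmatched {p} {q} (edge m _ t) s∈ = trans (cong (lookup T) m[s]≡s) (∉⇒false s∉T)
      where
      m[s]≡s : lookup m s ≡ s
      -- The tiling is an irrelevant field of the edge; the equation obtained from it may be used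
      -- since it is decidable.
      m[s]≡s = recompute (lookup m s Fin.≟ s) (Tiles.outside t s λ s∈∁ → x∈∁p⇒x∉p s∈∁ (x∈p∪q⁺ s∈))

    -- As `s` belongs to a plug, no domino of the tiling contains it, and `w` cancels on each of
    -- them. The tiling, fixing all other squares, is an involution as required by
    -- `total-involution`.
    total-tiled : ∀ {p q : Subset size} {m} → Empty (p ∩ q) → Tiles D (∁ (p ∪ q)) m → s ∈ p ⊎ s ∈ q →
                  total w p ℤ.+ total w q ≡ total w ⊤
    total-tiled {p} {q} {m} d t s∈ = trans
      (sym (total-∪ w p q (λ i i∈p i∈q → d (i , x∈p∩q⁺ (i∈p , i∈q)))))
      (trans (sym (ℤ.+-identityʳ _)) (trans (cong (ℤ._+_ (total w r)) (sym uncovered)) (total-∁ w r)))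
      where
      r = p ∪ q
      ≢s : ∀ {i} → i ∈ ∁ r → i ≢ s
      ≢s i∈ refl = x∈∁p⇒x∉p i∈ (x∈p∪q⁺ s∈)
      involutive : ∀ i → lookup m (lookup m i) ≡ i
      involutive i with i ∈? ∁ r
      ... | yes i∈ = Tiles.involutive t i i∈
      ... | no i∉  = trans (cong (lookup m) (Tiles.outside t i i∉)) (Tiles.outside t i i∉)
      uncovered : total w (∁ r) ≡ 0ℤ
      uncovered = total-involution w (∁ r) (lookup m) (Tiles.closed t) involutive
        (λ i i∈ → w-anti (Tiles.adjacent t i i∈) (≢s i∈) (≢s (Tiles.closed t i i∈)))

    total-edge : ∀ {p q} → Edge D p q → s ∈ cells p ⊎ s ∈ cells q →
                 total w (cells p) ℤ.+ total w (cells q) ≡ total w ⊤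
    total-edge (edge m d t) s∈ = recompute (_ ℤ.≟ _) (total-tiled d t s∈)

    cancel : ∀ {x y} → x ≈ y → x ∙ (y ⁻¹ ∙ 1#) ≈ 1#
    cancel x≈y = ≈-trans (∙-congʳ x≈y) (\\-leftDividesˡ _ 1#)

    cancel⁻ : ∀ {x y} → x ≈ y → x ⁻¹ ∙ (y ∙ 1#) ≈ 1#
    cancel⁻ x≈y = ≈-trans (∙-congʳ (⁻¹-cong x≈y)) (\\-leftDividesʳ _ 1#)

    bigon : ∀ π {p q} (f g : Edge D p q) → towardsT f ≡ towardsT g → φ π (f ◅ flip D g ◅ ε) ≈ 1#
    bigon 0ℙ {p} (edge _ _ _) (edge _ _ _) eq = cancel (≈-reflexive (cong (weigh (total w (cells p))) eq))
    bigon 1ℙ {q = q} (edge _ _ _) (edge _ _ _) eq = cancel⁻ (≈-reflexive (cong (weigh (total w (cells q))) eq))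

    -- The four labels around a domino cell cancel in one of two ways: the inner two and the outer
    -- two here, the first two and the last two in `paired`.
    nested : ∀ {a b c d} → b ≈ c → a ≈ d → a ∙ (b ⁻¹ ∙ (c ∙ (d ⁻¹ ∙ 1#))) ≈ 1#
    nested b≈c a≈d = ≈-trans (∙-congˡ (≈-trans (∙-congʳ (⁻¹-cong b≈c)) (\\-leftDividesʳ _ _))) (cancel a≈d)

    nested⁻ : ∀ {a b c d} → b ≈ c → a ≈ d → a ⁻¹ ∙ (b ∙ (c ⁻¹ ∙ (d ∙ 1#))) ≈ 1#
    nested⁻ b≈c a≈d = ≈-trans (∙-congˡ (≈-trans (∙-congʳ b≈c) (\\-leftDividesˡ _ _))) (cancel⁻ a≈d)

    paired : ∀ {a b c d} → a ≈ b → c ≈ d → a ∙ (b ⁻¹ ∙ (c ∙ (d ⁻¹ ∙ 1#))) ≈ 1#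
    paired a≈b c≈d = ≈-trans (∙-congˡ (∙-congˡ (cancel c≈d))) (cancel a≈b)

    paired⁻ : ∀ {a b c d} → a ≈ b → c ≈ d → a ⁻¹ ∙ (b ∙ (c ⁻¹ ∙ (d ∙ 1#))) ≈ 1#
    paired⁻ a≈b c≈d = ≈-trans (∙-congˡ (∙-congˡ (cancel⁻ c≈d))) (cancel⁻ a≈b)

    -- A flip moves the partner of s between two neighbours of s which have the
    -- fourth square of the 2 × 2 square as a common neighbour.
    flip-towardsT : ∀ {m m′} → HorizontalToVertical D m m′ → lookup T (lookup m s) ≡ lookup T (lookup m′ s)
    flip-towardsT {m} {m′} F = by-position (s Fin.≟ i) (s Fin.≟ j) (s Fin.≟ k) (s Fin.≟ l)
      where
      open HorizontalToVertical F
      j~i : Adj D j i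
      j~i rewrite at-i | at-j = right-adjacent a b
      k~i : Adj D k i
      k~i rewrite at-i | at-k = upper-adjacent a b
      l~j : Adj D l j
      l~j rewrite at-j | at-l = upper-adjacent (ℤ.suc a) b
      l~k : Adj D l k
      l~k rewrite at-k | at-l = right-adjacent a (ℤ.suc b)
      l≢i : l ≢ i
      l≢i l≡i = suc[i]≢i a (cong proj₁ (trans (sym at-l) (trans (cong square l≡i) at-i)))
      j≢k : j ≢ k
      j≢k j≡k = suc[i]≢i a (cong proj₁ (trans (sym at-j) (trans (cong square j≡k) at-k)))
      sym-adj : ∀ {x y} → Adj D x y → Adj D y x
      sym-adj {x} {y} = adj-sym (square x) (square y)
      through : ∀ {x y z} → Adj D y x → Adj D y z → x ≢ s → y ≢ s → z ≢ s → lookup T x ≡ lookup T z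
      through y~x y~z x≢s y≢s z≢s = trans (sym (T-closed y~x y≢s x≢s)) (T-closed y~z y≢s z≢s)
      via : ∀ {x y} → lookup m s ≡ x → lookup m′ s ≡ y → lookup T x ≡ lookup T y →
            lookup T (lookup m s) ≡ lookup T (lookup m′ s)
      via refl refl eq = eq
      mi = proj₁ before
      mj = proj₁ (proj₂ before)
      mk = proj₁ (proj₂ (proj₂ before))
      ml = proj₂ (proj₂ (proj₂ before))
      m′i = proj₁ after
      m′k = proj₁ (proj₂ after)
      m′j = proj₁ (proj₂ (proj₂ after))
      m′l = proj₂ (proj₂ (proj₂ after))
      by-position : Dec (s ≡ i) → Dec (s ≡ j) → Dec (s ≡ k) → Dec (s ≡ l) →
                    lookup T (lookup m s) ≡ lookup T (lookup m′ s)
      by-position (yes refl) _ _ _ = via mi m′i (through l~j l~k (adj⇒≢ j~i) l≢i (adj⇒≢ k~i))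
      by-position _ (yes refl) _ _ =
        via mj m′j (through k~i (sym-adj l~k) (adj⇒≢ j~i ∘ sym) (j≢k ∘ sym) (adj⇒≢ l~j))
      by-position _ _ (yes refl) _ =
        via mk m′k (through (sym-adj l~j) j~i (adj⇒≢ l~k) j≢k (adj⇒≢ k~i ∘ sym))
      by-position _ _ _ (yes refl) =
        via ml m′l (through (sym-adj k~i) (sym-adj j~i) (adj⇒≢ l~k ∘ sym) (l≢i ∘ sym) (adj⇒≢ l~j ∘ sym))
      by-position (no s≢i) (no s≢j) (no s≢k) (no s≢l) = cong (lookup T) (same s s≢i s≢j s≢k s≢l)

    -- Parity of length and both starting parities are treated at once: in `◅◅-cong`, the second
    -- path starts at a parity determined by the length of the first.
    φ-cong : ∀ {p q} {α β : Path D p q} → _≃_ D α β →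
             lengthParity D α ≡ lengthParity D β × (∀ π → φ π α ≈ φ π β)
    φ-cong ≃-refl = refl , λ _ → ≈-refl
    φ-cong (≃-sym e) = let (l , v) = φ-cong e in sym l , λ π → ≈-sym (v π)
    φ-cong (≃-trans e f) = let (l , v) = φ-cong e ; (l′ , v′) = φ-cong f in
      trans l l′ , λ π → ≈-trans (v π) (v′ π)
    φ-cong (◅◅-cong {α = α} {α′} {β} {β′} e f) =
      let (l , v) = φ-cong e ; (l′ , v′) = φ-cong f in
      trans (length-◅◅ α β) (trans (cong₂ ℙ._+_ l l′) (sym (length-◅◅ α′ β′))) ,
      λ π → ≈-trans (φ-◅◅ π α β) (≈-trans (∙-cong (v π)
              (≈-trans (v′ _) (≈-reflexive (cong (λ ρ → φ (π ℙ.+ ρ) β′) l)))) (≈-sym (φ-◅◅ π α′ β′)))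
    φ-cong (backtrack f) = refl , λ π → bigon π f f refl
    φ-cong (loop-cell f) = refl , λ { 0ℙ → cancel ≈-refl ; 1ℙ → cancel⁻ ≈-refl }
    φ-cong (flip-cell _ f g F) = refl , λ π → bigon π f g (flip-towardsT F)
    φ-cong (domino-cell {p₁} {p₂} {p₃} {p₄} i j i~j i∉ j∉ p₂≡ f₁ f₂ g₂ g₁ mg₂ mg₁) =
      refl , by-position (s Fin.≟ i) (s Fin.≟ j)
      where
      W : Plug D → ℤ
      W p = total w (cells p)
      i≢j = adj⇒≢ i~j
      weigh-cong : ∀ {x y b c} → x ≡ y → b ≡ c → weigh x b ≈ weigh y c
      weigh-cong refl refl = ≈-refl
      -- The domino of the cell covers `s`. Then `f₁` and `f₂` leave `s` unmatched, while `g₂` and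
      -- `g₁` give it the same partner, so consecutive edges cancel; from even position this
      -- compares the weights of `p₁` and `p₄`.
      cover : s ∈ cells p₂ → ∀ {t} → lookup (mates g₂) s ≡ t → lookup (mates g₁) s ≡ t →
              ∀ π → φ π (f₁ ◅ f₂ ◅ g₂ ◅ g₁ ◅ ε) ≈ 1#
      cover s∈p₂ m₂ m₁ = λ
        { 0ℙ → paired (weigh-cong W₁≡W₄ b≡) (weigh-cong (sym W₁≡W₄) c≡)
        ; 1ℙ → paired⁻ (weigh-cong {x = W p₂} refl b≡) (weigh-cong {x = W p₃} refl c≡) }
        where
        b≡ : towardsT f₁ ≡ towardsT f₂
        b≡ = trans (unmatched f₁ (inj₂ s∈p₂)) (sym (unmatched f₂ (inj₁ s∈p₂)))
        c≡ : towardsT g₂ ≡ towardsT g₁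
        c≡ = cong (lookup T) (trans m₂ (sym m₁))
        W₁≡W₄ : W p₁ ≡ W p₄
        W₁≡W₄ = ∙-cancelʳ (W p₂) (W p₁) (W p₄) (trans (total-edge f₁ (inj₂ s∈p₂))
          (trans (sym (total-edge f₂ (inj₁ s∈p₂))) (ℤ.+-comm (W p₂) (W p₄))))
      by-position : Dec (s ≡ i) → Dec (s ≡ j) → ∀ π → φ π (f₁ ◅ f₂ ◅ g₂ ◅ g₁ ◅ ε) ≈ 1#
      by-position (yes refl) _ = cover
        (subst (s ∈_) (sym p₂≡) (x∈p∪q⁺ {p = cells p₃} (inj₂ (x∈p∪q⁺ (inj₁ (x∈⁅x⁆ s))))))
        (trans (cong (λ m → lookup m s) mg₂) (lookup-addDomino-fst (mates f₂) i≢j))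
        (trans (cong (λ m → lookup m s) mg₁) (lookup-addDomino-fst (mates f₁) i≢j))
      by-position _ (yes refl) = cover
        (subst (s ∈_) (sym p₂≡) (x∈p∪q⁺ {p = cells p₃} (inj₂ (x∈p∪q⁺ {p = ⁅ i ⁆} (inj₂ (x∈⁅x⁆ s))))))
        (trans (cong (λ m → lookup m s) mg₂) (lookup-addDomino-snd (mates f₂)))
        (trans (cong (λ m → lookup m s) mg₁) (lookup-addDomino-snd (mates f₁)))
      -- The domino avoids `s`. Now `f₁` agrees with `g₁` and `f₂` with `g₂` on the partner of `s`;
      -- from odd position the weights compared are those of `p₂` and `p₃`, which differ by a domino
      -- of weight zero.
      by-position (no s≢i) (no s≢j) = λ
        { 0ℙ → nested (weigh-cong {x = W p₄} refl b₂≡) (weigh-cong {x = W p₁} refl b₁≡)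
        ; 1ℙ → nested⁻ (weigh-cong W₂≡W₃ b₂≡) (weigh-cong W₂≡W₃ b₁≡) }
        where
        b₁≡ : towardsT f₁ ≡ towardsT g₁
        b₁≡ = cong (lookup T) (sym (trans (cong (λ m → lookup m s) mg₁) (lookup-addDomino-other (mates f₁) s≢i s≢j)))
        b₂≡ : towardsT f₂ ≡ towardsT g₂
        b₂≡ = cong (lookup T) (sym (trans (cong (λ m → lookup m s) mg₂) (lookup-addDomino-other (mates f₂) s≢i s≢j)))
        W₂≡W₃ : W p₂ ≡ W p₃
        W₂≡W₃ = total-domino w i≢j (w-anti i~j (s≢i ∘ sym) (s≢j ∘ sym)) i∉ j∉ p₂≡

    evenHom : Group.Carrier (evenDominoGroup D) → Carrier
    evenHom (α , _) = φ 0ℙ α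

    φ-even : ∀ {p q r} (α : Path D p q) (β : Path D q r) → lengthParity D α ≡ 0ℙ →
             φ 0ℙ (α ◅◅ β) ≈ φ 0ℙ α ∙ φ 0ℙ β
    φ-even α β even = ≈-trans (φ-◅◅ 0ℙ α β) (∙-congˡ (≈-reflexive (cong (λ ρ → φ ρ β) even)))

    evenHom-isGroupHomomorphism :
      IsGroupHomomorphism (Group.rawGroup (evenDominoGroup D)) (Group.rawGroup G) evenHom
    evenHom-isGroupHomomorphism = record
      { isMonoidHomomorphism = record
        { isMagmaHomomorphism = record
          { isRelHomomorphism = record { cong = λ e → proj₂ (φ-cong e) 0ℙ }
          ; homo = homo
          }
        ; ε-homo = ≈-refl
        }
      ; ⁻¹-homo = λ x → inverseˡ-unique _ _ (≈-trans (≈-sym (homo (x E.⁻¹) x)) (proj₂ (φ-cong (E.inverseˡ x)) 0ℙ))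
      }
      where
      module E = Group (evenDominoGroup D)
      homo : ∀ x y → evenHom (x E.∙ y) ≈ evenHom x ∙ evenHom y
      homo (α , even) (β , _) = φ-even α β even

-- Closed paths around a square

∉-∪ : ∀ {n x} {p q : Subset n} → x ∉ p → x ∉ q → x ∉ p ∪ q
∉-∪ {p = p} {q} x∉p x∉q x∈ = [ x∉p , x∉q ]′ (x∈p∪q⁻ p q x∈)

∉-pair : ∀ {n} {x i j : Fin n} → x ≢ i → x ≢ j → x ∉ ⁅ i ⁆ ∪ ⁅ j ⁆
∉-pair {i = i} {j} x≢i x≢j = ∉-∪ (x≢i ∘ x∈⁅y⁆⇒x≡y i) (x≢j ∘ x∈⁅y⁆⇒x≡y j)

module Moves (D : Region) (balanced-⊤ : Balanced D ⊤) where
  open Region D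
  open Colours D

  record Step (i j : Fin size) (p q : Subset size) : Set where
    field
      i~j : Adj D i j
      i∉p : i ∉ p
      j∉p : j ∉ p
      q≡  : q ≡ p ∪ (⁅ i ⁆ ∪ ⁅ j ⁆)

    total-step : ∀ w → w i ℤ.+ w j ≡ 0ℤ → total w q ≡ total w p
    total-step w w≡ = total-domino D w (adj⇒≢ i~j) w≡ i∉p j∉p q≡

    balanced-up : Balanced D p → Balanced D q
    balanced-up b = total⇒balanced q (trans (total-step charge (adj⇒charge i~j)) (balanced⇒total p b))

    balanced-down : Balanced D q → Balanced D p
    balanced-down b = total⇒balanced p (trans (sym (total-step charge (adj⇒charge i~j))) (balanced⇒total q b))

    p⊆q : ∀ {x} → x ∈ p → x ∈ q
    p⊆q x∈p = subst (_ ∈_) (sym q≡) (x∈p∪q⁺ (inj₁ x∈p))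

    i∈q : i ∈ q
    i∈q = subst (i ∈_) (sym q≡) (x∈p∪q⁺ {p = p} (inj₂ (x∈p∪q⁺ (inj₁ (x∈⁅x⁆ i)))))

    j∈q : j ∈ q
    j∈q = subst (j ∈_) (sym q≡) (x∈p∪q⁺ {p = p} (inj₂ (x∈p∪q⁺ {p = ⁅ i ⁆} (inj₂ (x∈⁅x⁆ j)))))

    new : ∀ {x} → x ∈ q → x ∉ p → x ≡ i ⊎ x ≡ j
    new {x} x∈q x∉p with x∈p∪q⁻ p _ (subst (x ∈_) q≡ x∈q)
    ... | inj₁ x∈p = contradiction x∈p x∉p
    ... | inj₂ x∈d with x∈p∪q⁻ ⁅ i ⁆ ⁅ j ⁆ x∈d
    ...   | inj₁ x∈i = inj₁ (x∈⁅y⁆⇒x≡y i x∈i)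
    ...   | inj₂ x∈j = inj₂ (x∈⁅y⁆⇒x≡y j x∈j)

  balanced-∁ : ∀ {c} → Balanced D c → Balanced D (∁ c)
  balanced-∁ {c} b = total⇒balanced (∁ c) (trans (sym (ℤ.+-identityˡ _)) (trans
    (cong (ℤ._+ total charge (∁ c)) (sym (balanced⇒total c b)))
    (trans (total-∁ charge c) (balanced⇒total ⊤ balanced-⊤))))

  complement : Plug D → Plug D
  complement (plug c b) = plug (∁ c) (balanced-∁ {c} b)

  unpaired : Mates D
  unpaired = Vec.allFin size

  tiles-domino : ∀ {i j p q} → Step i j p q → Tiles D (∁ (p ∪ ∁ q)) (addDomino D i j unpaired)
  tiles-domino {i} {j} {p} {q} st = record
    { adjacent   = λ x x∈ → on-domino (either x∈) (subst (Adj D i) (sym at-i) i~j)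
        (subst (Adj D j) (sym at-j) (adj-sym (square i) (square j) i~j))
    ; closed     = λ x x∈ → on-domino (either x∈) (subst (_∈ r) (sym at-i) j∈r) (subst (_∈ r) (sym at-j) i∈r)
    ; involutive = λ x x∈ → on-domino (either x∈) (trans (cong (lookup m) at-i) at-j)
        (trans (cong (lookup m) at-j) at-i)
    ; outside    = λ x x∉ → trans
        (lookup-addDomino-other D unpaired (λ { refl → x∉ i∈r }) (λ { refl → x∉ j∈r })) (lookup-allFin x)
    }
    where
    open Step st
    r = ∁ (p ∪ ∁ q)
    m = addDomino D i j unpaired
    on-domino : ∀ {A : Fin size → Set} {x} → x ≡ i ⊎ x ≡ j → A i → A j → A x
    on-domino (inj₁ refl) Ai _ = Ai
    on-domino (inj₂ refl) _ Aj = Aj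
    at-i : lookup m i ≡ j
    at-i = lookup-addDomino-fst D unpaired (adj⇒≢ i~j)
    at-j : lookup m j ≡ i
    at-j = lookup-addDomino-snd D unpaired
    i∈r : i ∈ r
    i∈r = x∉p⇒x∈∁p (∉-∪ i∉p (λ i∈∁q → x∈∁p⇒x∉p i∈∁q i∈q))
    j∈r : j ∈ r
    j∈r = x∉p⇒x∈∁p (∉-∪ j∉p (λ j∈∁q → x∈∁p⇒x∉p j∈∁q j∈q))
    either : ∀ {x} → x ∈ r → x ≡ i ⊎ x ≡ j
    either {x} x∈r = new
      (decidable-stable (x ∈? q) λ x∉q → x∈∁p⇒x∉p x∈r (x∈p∪q⁺ {p = p} (inj₂ (x∉p⇒x∈∁p x∉q))))
      (λ x∈p → x∈∁p⇒x∉p x∈r (x∈p∪q⁺ (inj₁ x∈p)))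

  tiles-nothing : ∀ {c} → Tiles D (∁ (∁ c ∪ c)) unpaired
  tiles-nothing {c} = record
    { adjacent   = λ x x∈ → contradiction x∈ (nothing x)
    ; closed     = λ x x∈ → contradiction x∈ (nothing x)
    ; involutive = λ x x∈ → contradiction x∈ (nothing x)
    ; outside    = λ x _ → lookup-allFin x
    }
    where
    nothing : ∀ x → x ∉ ∁ (∁ c ∪ c)
    nothing x x∈ = x∈∁p⇒x∉p x∈ (x∈p∪q⁺ (inj₁ (x∉p⇒x∈∁p λ x∈c → x∈∁p⇒x∉p x∈ (x∈p∪q⁺ {p = ∁ c} (inj₂ x∈c)))))

  module _ {i j : Fin size} {p q : Plug D} (st : Step i j (cells p) (cells q)) where

    place : Edge D p (complement q)
    place = edge (addDomino D i j unpaired)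
      (λ (x , x∈) → let (x∈p , x∈∁q) = x∈p∩q⁻ (cells p) (∁ (cells q)) x∈ in
                    x∈∁p⇒x∉p x∈∁q (Step.p⊆q st x∈p))
      (tiles-domino st)

    fill : Edge D (complement q) q
    fill = edge unpaired
      (λ (x , x∈) → let (x∈∁q , x∈q) = x∈p∩q⁻ (∁ (cells q)) (cells q) x∈ in x∈∁p⇒x∉p x∈∁q x∈q)
      (tiles-nothing {cells q})

    -- Two floors add a domino: `place` tiles only the squares `i` and `j`, which are the complement
    -- of `p ∪ ∁ q`, and `fill` joins complementary plugs by the empty tiling. The length is even,
    -- so consecutive moves all start in even position.
    add : Path D p q
    add = place ◅ fill ◅ ε

    remove : Path D q p
    remove = flip D fill ◅ flip D place ◅ ε

  module Hexagons
    (s : Fin size) (w : Fin size → ℤ) (w-anti : ∀ {i j} → Adj D i j → i ≢ s → j ≢ s → w i ℤ.+ w j ≡ 0ℤ)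
    (T : Subset size) (s∉T : s ∉ T)
    (T-closed : ∀ {i j} → Adj D i j → i ≢ s → j ≢ s → lookup T i ≡ lookup T j)
    (G : Group 0ℓ 0ℓ) (label : ℤ → Group.Carrier G) (label-0 : Group._≈_ G (label 0ℤ) (Group.ε G)) where

    open Group G renaming (ε to 1#; refl to ≈-refl; sym to ≈-sym; trans to ≈-trans; reflexive to ≈-reflexive)
    open GroupProperties G using (ε⁻¹≈ε)
    open Labelling D s w w-anti T s∉T T-closed G label

    unpaired-T : lookup T (lookup unpaired s) ≡ false
    unpaired-T = trans (cong (lookup T) (lookup-allFin s)) (∉⇒false s∉T)

    dominoWeight : (i j : Fin size) (p : Subset size) → Carrier
    dominoWeight i j p = weigh (total w p) (lookup T (lookup (addDomino D i j unpaired) s))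

    weigh-false : ∀ x {b} → b ≡ false → weigh x b ≈ 1#
    weigh-false x refl = ≈-refl

    -- The second floor has a trivial label, because `unpaired` fixes `s` and `s` is not in `T`.
    φ-add : ∀ {i j p q} (st : Step i j (cells p) (cells q)) →
            φ 0ℙ (add {p = p} {q} st) ≈ dominoWeight i j (cells p)
    φ-add {q = q} st = ≈-trans (∙-congˡ (≈-trans (identityʳ _)
      (≈-trans (⁻¹-cong (weigh-false (total w (cells q)) unpaired-T)) ε⁻¹≈ε))) (identityʳ _)

    φ-remove : ∀ {i j p q} (st : Step i j (cells p) (cells q)) →
               φ 0ℙ (remove {p = p} {q} st) ≈ dominoWeight i j (cells p) ⁻¹
    φ-remove {q = q} st = ≈-trans (∙-cong (weigh-false (total w (cells q)) unpaired-T) (identityʳ _)) (identityˡ _)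

    -- Data for the closed path through the plugs `∅`, `s t₁`, `s t₁ t₂ u`, `t₁ u`, `t₁ u s t₃`,
    -- `t₃ u`, `t₃ u s t₂`, `s t₃`, `∅`. Each move adds or removes `t₂ u` or a domino containing
    -- `s`; the pairs `t₁ u` and `t₃ u` are not dominoes of the path.
    record Hexagon : Set where
      field
        t₁ t₂ t₃ u        : Fin size
        s~t₁              : Adj D s t₁
        s~t₂              : Adj D s t₂
        s~t₃              : Adj D s t₃
        t₂~u              : Adj D t₂ u
        t₁∉T              : t₁ ∉ T
        t₂∉T              : t₂ ∉ T
        t₃∈T              : t₃ ∈ T
        t₁≢t₂             : t₁ ≢ t₂
        u≢s               : u ≢ s
        u≢t₁              : u ≢ t₁
        u≢t₃              : u ≢ t₃

    module _ (H : Hexagon) where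
      open Hexagon H

      private
        s≢t₁ = adj⇒≢ s~t₁
        s≢t₂ = adj⇒≢ s~t₂
        s≢t₃ = adj⇒≢ s~t₃
        t₂≢u = adj⇒≢ t₂~u
        t₁≢t₃ : t₁ ≢ t₃
        t₁≢t₃ refl = t₁∉T t₃∈T
        t₂≢t₃ : t₂ ≢ t₃
        t₂≢t₃ refl = t₂∉T t₃∈T

        c₁ c₂ c₃ c₄ c₅ c₆ c₇ : Subset size
        c₁ = ⊥ ∪ (⁅ s ⁆ ∪ ⁅ t₁ ⁆)
        c₂ = c₁ ∪ (⁅ t₂ ⁆ ∪ ⁅ u ⁆)
        c₃ = ⁅ t₁ ⁆ ∪ ⁅ u ⁆
        c₄ = c₃ ∪ (⁅ s ⁆ ∪ ⁅ t₃ ⁆)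
        c₅ = ⁅ t₃ ⁆ ∪ ⁅ u ⁆
        c₆ = c₅ ∪ (⁅ s ⁆ ∪ ⁅ t₂ ⁆)
        c₇ = ⊥ ∪ (⁅ s ⁆ ∪ ⁅ t₃ ⁆)

        open UnionSolver (∪-idempotentCommutativeMonoid size) using (_⊜_; id) renaming (solve to solve-∪; _⊕_ to _⊍_)

        st₁ : Step s t₁ ⊥ c₁
        st₁ = record
          { i~j = s~t₁ ; i∉p = ∉⊥ ; j∉p = ∉⊥
          ; q≡ = refl
          }
        st₂ : Step t₂ u c₁ c₂
        st₂ = record
          { i~j = t₂~u ; i∉p = ∉-∪ ∉⊥ (∉-pair (s≢t₂ ∘ sym) (t₁≢t₂ ∘ sym))
          ; j∉p = ∉-∪ ∉⊥ (∉-pair u≢s u≢t₁)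
          ; q≡ = refl
          }
        st₃ : Step s t₂ c₃ c₂
        st₃ = record
          { i~j = s~t₂ ; i∉p = ∉-pair s≢t₁ (u≢s ∘ sym) ; j∉p = ∉-pair (t₁≢t₂ ∘ sym) t₂≢u
          ; q≡ = solve-∪ 4 (λ s t₁ t₂ u → (id ⊍ (s ⊍ t₁)) ⊍ (t₂ ⊍ u) ⊜ (t₁ ⊍ u) ⊍ (s ⊍ t₂)) refl
              ⁅ s ⁆ ⁅ t₁ ⁆ ⁅ t₂ ⁆ ⁅ u ⁆
          }
        st₄ : Step s t₃ c₃ c₄
        st₄ = record
          { i~j = s~t₃ ; i∉p = ∉-pair s≢t₁ (u≢s ∘ sym) ; j∉p = ∉-pair (t₁≢t₃ ∘ sym) (u≢t₃ ∘ sym)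
          ; q≡ = refl
          }
        st₅ : Step s t₁ c₅ c₄
        st₅ = record
          { i~j = s~t₁ ; i∉p = ∉-pair s≢t₃ (u≢s ∘ sym) ; j∉p = ∉-pair t₁≢t₃ (u≢t₁ ∘ sym)
          ; q≡ = solve-∪ 4 (λ s t₁ t₃ u → (t₁ ⊍ u) ⊍ (s ⊍ t₃) ⊜ (t₃ ⊍ u) ⊍ (s ⊍ t₁)) refl
              ⁅ s ⁆ ⁅ t₁ ⁆ ⁅ t₃ ⁆ ⁅ u ⁆
          }
        st₆ : Step s t₂ c₅ c₆
        st₆ = record
          { i~j = s~t₂ ; i∉p = ∉-pair s≢t₃ (u≢s ∘ sym) ; j∉p = ∉-pair t₂≢t₃ t₂≢u
          ; q≡ = refl
          }
        st₇ : Step t₂ u c₇ c₆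
        st₇ = record
          { i~j = t₂~u ; i∉p = ∉-∪ ∉⊥ (∉-pair (s≢t₂ ∘ sym) t₂≢t₃) ; j∉p = ∉-∪ ∉⊥ (∉-pair u≢s u≢t₃)
          ; q≡ = solve-∪ 4 (λ s t₂ t₃ u → (t₃ ⊍ u) ⊍ (s ⊍ t₂) ⊜ (id ⊍ (s ⊍ t₃)) ⊍ (t₂ ⊍ u)) refl
              ⁅ s ⁆ ⁅ t₂ ⁆ ⁅ t₃ ⁆ ⁅ u ⁆
          }
        st₈ : Step s t₃ ⊥ c₇
        st₈ = record
          { i~j = s~t₃ ; i∉p = ∉⊥ ; j∉p = ∉⊥
          ; q≡ = refl
          }

        b₁ : Balanced D c₁
        b₁ = Step.balanced-up st₁ (total⇒balanced ⊥ (total-⊥ charge))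
        b₂ : Balanced D c₂
        b₂ = Step.balanced-up st₂ b₁
        -- `c₃` and `c₅` are balanced because adding a domino to them yields a balanced set.
        b₃ : Balanced D c₃
        b₃ = Step.balanced-down st₃ b₂
        b₄ : Balanced D c₄
        b₄ = Step.balanced-up st₄ b₃
        b₅ : Balanced D c₅
        b₅ = Step.balanced-down st₅ b₄
        b₆ : Balanced D c₆
        b₆ = Step.balanced-up st₆ b₅
        b₇ : Balanced D c₇
        b₇ = Step.balanced-up st₈ (total⇒balanced ⊥ (total-⊥ charge))

        p₀ p₁ p₂ p₃ p₄ p₅ p₆ p₇ : Plug D
        p₀ = emptyPlug D
        p₁ = plug c₁ b₁
        p₂ = plug c₂ b₂
        p₃ = plug c₃ b₃
        p₄ = plug c₄ b₄
        p₅ = plug c₅ b₅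
        p₆ = plug c₆ b₆
        p₇ = plug c₇ b₇

        α₁ = add {p = p₀} {p₁} st₁
        α₂ = add {p = p₁} {p₂} st₂
        α₃ = remove {p = p₃} {p₂} st₃
        α₄ = add {p = p₃} {p₄} st₄
        α₅ = remove {p = p₅} {p₄} st₅
        α₆ = add {p = p₅} {p₆} st₆
        α₇ = remove {p = p₇} {p₆} st₇
        α₈ = remove {p = p₀} {p₇} st₈

        β₇ = α₇ ◅◅ α₈
        β₆ = α₆ ◅◅ β₇
        β₅ = α₅ ◅◅ β₆
        β₄ = α₄ ◅◅ β₅
        β₃ = α₃ ◅◅ β₄
        β₂ = α₂ ◅◅ β₃

      loop : Path D (emptyPlug D) (emptyPlug D)
      loop = α₁ ◅◅ β₂

      -- The partner of `s` lies in `T` in two floors only: when `s t₃` is added to `t₁ u`, which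
      -- gives the label, and when it is removed at the end, where the weight is that of the empty
      -- plug and the label is trivial.
      φ-loop : φ 0ℙ loop ≈ label (w t₁ ℤ.+ w u)
      φ-loop = ≈-trans
        (trivial α₁ β₂ (add≈1 p₀ p₁ st₁ T-t₁) (trivial α₂ β₃ (add≈1 p₁ p₂ st₂ T-away)
        (trivial α₃ β₄ (remove≈1 p₃ p₂ st₃ T-t₂)
        (≈-trans (φ-even α₄ β₅ refl) (∙-cong (≈-trans (φ-add {p = p₃} {p₄} st₄) (weigh-true T-t₃))
        (trivial α₅ β₆ (remove≈1 p₅ p₄ st₅ T-t₁) (trivial α₆ β₇ (add≈1 p₅ p₆ st₆ T-t₂)
        (trivial α₇ α₈ (remove≈1 p₇ p₆ st₇ T-away)
        (≈-trans (φ-remove {p = p₀} {p₇} st₈) (≈-trans (⁻¹-cong (≈-trans (weigh-true T-t₃)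
          (≈-trans (≈-reflexive (cong label (total-⊥ w))) label-0))) ε⁻¹≈ε))))))))))
        (≈-trans (identityʳ _) (≈-reflexive (cong label (total-pair D w (u≢t₁ ∘ sym)))))
        where
        weigh-true : ∀ {x b} → b ≡ true → weigh x b ≈ label x
        weigh-true refl = ≈-refl
        T-s : ∀ {t} → s ≢ t → lookup T (lookup (addDomino D s t unpaired) s) ≡ lookup T t
        T-s s≢t = cong (lookup T) (lookup-addDomino-fst D unpaired s≢t)
        T-t₁ : lookup T (lookup (addDomino D s t₁ unpaired) s) ≡ false
        T-t₁ = trans (T-s s≢t₁) (∉⇒false t₁∉T)
        T-t₂ : lookup T (lookup (addDomino D s t₂ unpaired) s) ≡ false
        T-t₂ = trans (T-s s≢t₂) (∉⇒false t₂∉T)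
        T-t₃ : lookup T (lookup (addDomino D s t₃ unpaired) s) ≡ true
        T-t₃ = trans (T-s s≢t₃) (∈⇒true t₃∈T)
        T-away : lookup T (lookup (addDomino D t₂ u unpaired) s) ≡ false
        T-away = trans (cong (lookup T) (lookup-addDomino-other D unpaired s≢t₂ (u≢s ∘ sym))) unpaired-T
        trivial : ∀ {p q r x} (α : Path D p q) (β : Path D q r) → lengthParity D α ≡ 0ℙ × φ 0ℙ α ≈ 1# →
                  φ 0ℙ β ≈ x → φ 0ℙ (α ◅◅ β) ≈ x
        trivial α β (even , α≈1) β≈x = ≈-trans (φ-even α β even) (≈-trans (∙-cong α≈1 β≈x) (identityˡ _))
        add≈1 : ∀ {i j} p q (st : Step i j (cells p) (cells q)) →
                lookup T (lookup (addDomino D i j unpaired) s) ≡ false →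
                lengthParity D (add {p = p} {q} st) ≡ 0ℙ × φ 0ℙ (add {p = p} {q} st) ≈ 1#
        add≈1 p q st eq = refl , ≈-trans (φ-add {p = p} {q} st) (weigh-false (total w (cells p)) eq)
        remove≈1 : ∀ {i j} p q (st : Step i j (cells p) (cells q)) →
                   lookup T (lookup (addDomino D i j unpaired) s) ≡ false →
                   lengthParity D (remove {p = p} {q} st) ≡ 0ℙ × φ 0ℙ (remove {p = p} {q} st) ≈ 1#
        remove≈1 p q st eq = refl , ≈-trans (φ-remove {p = p} {q} st)
          (≈-trans (⁻¹-cong (weigh-false (total w (cells p)) eq)) ε⁻¹≈ε)

      attained : ∃ λ x → evenHom x ≈ label (w t₁ ℤ.+ w u)
      attained = (loop , refl) , φ-loop

-- Components of the complement of a square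

open FreeGroup using (Term; gen; ≈-refl; ≈-trans; ⁻¹-cong; ∙-cong)

signLabel : ℤ → Term (Fin 2)
signLabel (+ 0)           = FreeGroup.e
signLabel (+ ℕ.suc _)     = gen zero
signLabel -[1+ _ ]        = gen (suc zero)

card-∪ : ∀ {n} (p q : Subset n) → card (p ∪ q) ≤ card p ℕ.+ card q
card-∪ Vec.[] Vec.[] = z≤n
card-∪ (true Vec.∷ p)  (true Vec.∷ q)  = s≤s (ℕ.≤-trans (card-∪ p q) (ℕ.+-monoʳ-≤ (card p) (ℕ.n≤1+n (card q))))
card-∪ (true Vec.∷ p)  (false Vec.∷ q) = s≤s (card-∪ p q)
card-∪ (false Vec.∷ p) (true Vec.∷ q)  = ℕ.≤-trans (s≤s (card-∪ p q)) (ℕ.≤-reflexive (sym (ℕ.+-suc (card p) (card q))))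
card-∪ (false Vec.∷ p) (false Vec.∷ q) = card-∪ p q

module Theorem (D : Region) (H : IsQuadriculatedDisk D) (balanced-⊤ : Balanced D ⊤)
               (s : Fin (Region.size D)) where
  open Region D
  open Colours D
  open Moves D balanced-⊤
  open Plane.Connectivity D H using (connected)

  sym-adj : ∀ {i j} → Adj D i j → Adj D j i
  sym-adj {i} {j} = adj-sym (square i) (square j)

  adj? : ∀ i j → Dec (Adj D i j)
  adj? i j = _ ℕ.≟ _

  -- A union of components of the complement of `s` rather than a single one, so that the squares
  -- left over by three of them form a class as well.
  record Class (c : Subset size) : Set where
    field
      s∉     : s ∉ c
      closed : ∀ {i j} → i ∈ c → Adj D i j → j ≢ s → j ∈ c

    lookup-closed : ∀ {i j} → Adj D i j → i ≢ s → j ≢ s → lookup c i ≡ lookup c j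
    lookup-closed {i} {j} i~j i≢s j≢s with i ∈? c
    ... | yes i∈c = trans (∈⇒true i∈c) (sym (∈⇒true (closed i∈c i~j j≢s)))
    ... | no i∉c  = trans (∉⇒false i∉c) (sym (∉⇒false λ j∈c → i∉c (closed j∈c (sym-adj i~j) i≢s)))

    -- Without a neighbour of `s`, the class would be closed under adjacency in all of `D`, and
    -- `connected` would put `s` into it.
    touches : Nonempty c → ∃ λ t → t ∈ c × Adj D s t
    touches (i , i∈c) = decidable-stable (Fin.any? λ t → (t ∈? c) ×-dec adj? s t) λ none →
      s∉ (connected (_∈? c) (λ i∈c i~j → closed i∈c i~j λ { refl → none (_ , i∈c , sym-adj i~j) }) i∈c)

  Disjoint : Subset size → Subset size → Set
  Disjoint c d = ∀ {i} → i ∈ c → i ∉ d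

  distinct : ∀ {c d} → Disjoint c d → ∀ {i j} → i ∈ c → j ∈ d → i ≢ j
  distinct c∥d i∈c j∈d refl = c∥d i∈c j∈d

  -- The colour weight, normalised by the colour of `s` so that it is 1 on the neighbours of `s`.
  σ : Fin size → ℤ
  σ i = if does (color (square i) ℙ.≟ color (square s)) then -1ℤ else 1ℤ

  σ-anti : ∀ {i j} → Adj D i j → σ i ℤ.+ σ j ≡ 0ℤ
  σ-anti {i} {j} i~j rewrite adjacent⇒color (square i) (square j) i~j
    with color (square j) | color (square s)
  ... | 0ℙ | 0ℙ = refl
  ... | 0ℙ | 1ℙ = refl
  ... | 1ℙ | 0ℙ = refl
  ... | 1ℙ | 1ℙ = refl

  σ-neighbour : ∀ {t} → Adj D s t → σ t ≡ 1ℤ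
  σ-neighbour {t} s~t rewrite adjacent⇒color (square s) (square t) s~t with color (square t)
  ... | 0ℙ = refl
  ... | 1ℙ = refl

  σ-second : ∀ {t u} → Adj D s t → Adj D t u → σ u ≡ -1ℤ
  σ-second {t} {u} s~t t~u = ∙-cancelˡ 1ℤ _ _ (trans (cong (ℤ._+ σ u) (sym (σ-neighbour s~t))) (σ-anti t~u))

  module Weighted {c₁ c₂ T : Subset size} (C₁ : Class c₁) (C₂ : Class c₂) (C₃ : Class T)
                  (c₁∥c₂ : Disjoint c₁ c₂) (c₁∥T : Disjoint c₁ T) (c₂∥T : Disjoint c₂ T) where

    w : Fin size → ℤ
    w i = if lookup c₁ i then σ i else if lookup c₂ i then ℤ.- σ i else 0ℤ

    w-anti : ∀ {i j} → Adj D i j → i ≢ s → j ≢ s → w i ℤ.+ w j ≡ 0ℤ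
    w-anti {i} {j} i~j i≢s j≢s
      rewrite Class.lookup-closed C₁ i~j i≢s j≢s | Class.lookup-closed C₂ i~j i≢s j≢s
      with lookup c₁ j | lookup c₂ j
    ... | true  | _     = σ-anti i~j
    ... | false | true  = trans (sym (ℤ.neg-distrib-+ (σ i) (σ j))) (cong ℤ.-_ (σ-anti i~j))
    ... | false | false = refl

    w-c₁ : ∀ {i} → i ∈ c₁ → w i ≡ σ i
    w-c₁ i∈c₁ rewrite ∈⇒true i∈c₁ = refl

    w-c₂ : ∀ {i} → i ∈ c₂ → w i ≡ ℤ.- σ i
    w-c₂ i∈c₂ rewrite ∉⇒false (λ i∈c₁ → c₁∥c₂ i∈c₁ i∈c₂) | ∈⇒true i∈c₂ = refl

    w-other : ∀ {i} → i ∉ c₁ → i ∉ c₂ → w i ≡ 0ℤ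
    w-other i∉c₁ i∉c₂ rewrite ∉⇒false i∉c₁ | ∉⇒false i∉c₂ = refl

    open Hexagons s w w-anti T (Class.s∉ C₃) (Class.lookup-closed C₃) (freeGroup (Fin 2)) signLabel
      (≈-refl {x = FreeGroup.e})
    open Labelling D s w w-anti T (Class.s∉ C₃) (Class.lookup-closed C₃) (freeGroup (Fin 2)) signLabel
      using (evenHom; evenHom-isGroupHomomorphism)
    open IsGroupHomomorphism evenHom-isGroupHomomorphism

    -- The two hexagons attain the two generators, and every other group term is reached by
    -- induction on its formation.
    irregular : (H₁ H₂ : Hexagon) → 0ℤ ℤ.< w (Hexagon.t₁ H₁) ℤ.+ w (Hexagon.u H₁) →
                w (Hexagon.t₁ H₂) ℤ.+ w (Hexagon.u H₂) ℤ.< 0ℤ → StronglyIrregular D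
    irregular H₁ H₂ pos neg = evenHom , evenHom-isGroupHomomorphism ,
      λ y → let (x , fx≈y) = surjective y in x , λ {z} z≈x → ≈-trans (⟦⟧-cong {z} {x} z≈x) fx≈y
      where
      module E = Group (evenDominoGroup D)
      label-pos : ∀ {x} → 0ℤ ℤ.< x → signLabel x ≡ gen zero
      label-pos (ℤ.+<+ (s≤s _)) = refl
      label-neg : ∀ {x} → x ℤ.< 0ℤ → signLabel x ≡ gen (suc zero)
      label-neg ℤ.-<+ = refl
      Attained : Term (Fin 2) → Set
      Attained y = ∃ λ x → FreeGroup._≈_ (Fin 2) (evenHom x) y
      surjective : ∀ y → Attained y
      surjective (gen zero)       = subst Attained (label-pos pos) (attained H₁)
      surjective (gen (suc zero)) = subst Attained (label-neg neg) (attained H₂)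
      surjective FreeGroup.e      = E.ε , ≈-refl
      surjective (y FreeGroup.∙ y′) = let (x , p) = surjective y ; (x′ , p′) = surjective y′ in
        x E.∙ x′ , ≈-trans (homo x x′) (∙-cong p p′)
      surjective (y FreeGroup.⁻¹) = let (x , p) = surjective y in x E.⁻¹ , ≈-trans (⁻¹-homo x) (⁻¹-cong p)

  -- Arms at `s` and the generators that they attain.

  record Arm (c : Subset size) : Set where
    field
      class : Class c
      t     : Fin size
      t∈    : t ∈ c
      s~t   : Adj D s t
    open Class class public

  record LongArm (c : Subset size) : Set where
    field
      arm : Arm c
      u   : Fin size
      t~u : Adj D (Arm.t arm) u
      u≢s : u ≢ s
    open Arm arm public
    u∈ : u ∈ c
    u∈ = closed t∈ t~u u≢s

  -- The exchange of the roles of the long arms changes the sign: `w t₁ + w u` is `1 + 1` for the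
  -- first hexagon and `-1 - 1` for the second.
  two-long : ∀ {c₁ c₂ T} → LongArm c₁ → LongArm c₂ → Arm T →
             Disjoint c₁ c₂ → Disjoint c₁ T → Disjoint c₂ T → StronglyIrregular D
  two-long A₁ A₂ A₃ c₁∥c₂ c₁∥T c₂∥T = irregular
    (record { t₁ = A₁.t ; t₂ = A₂.t ; t₃ = A₃.t ; u = A₂.u ; s~t₁ = A₁.s~t ; s~t₂ = A₂.s~t ; s~t₃ = A₃.s~t
            ; t₂~u = A₂.t~u ; t₁∉T = c₁∥T A₁.t∈ ; t₂∉T = c₂∥T A₂.t∈ ; t₃∈T = A₃.t∈
            ; t₁≢t₂ = distinct c₁∥c₂ A₁.t∈ A₂.t∈ ; u≢s = A₂.u≢s
            ; u≢t₁ = distinct c₁∥c₂ A₁.t∈ A₂.u∈ ∘ sym ; u≢t₃ = distinct c₂∥T A₂.u∈ A₃.t∈ })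
    (record { t₁ = A₂.t ; t₂ = A₁.t ; t₃ = A₃.t ; u = A₁.u ; s~t₁ = A₂.s~t ; s~t₂ = A₁.s~t ; s~t₃ = A₃.s~t
            ; t₂~u = A₁.t~u ; t₁∉T = c₂∥T A₂.t∈ ; t₂∉T = c₁∥T A₁.t∈ ; t₃∈T = A₃.t∈
            ; t₁≢t₂ = distinct c₁∥c₂ A₁.t∈ A₂.t∈ ∘ sym ; u≢s = A₁.u≢s
            ; u≢t₁ = distinct c₁∥c₂ A₁.u∈ A₂.t∈ ; u≢t₃ = distinct c₁∥T A₁.u∈ A₃.t∈ })
    (subst (0ℤ ℤ.<_) (sym (cong₂ ℤ._+_ (trans (w-c₁ A₁.t∈) (σ-neighbour A₁.s~t))
                                       (trans (w-c₂ A₂.u∈) (cong ℤ.-_ (σ-second A₂.s~t A₂.t~u))))) (ℤ.+<+ (s≤s z≤n)))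
    (subst (ℤ._< 0ℤ) (sym (cong₂ ℤ._+_ (trans (w-c₂ A₂.t∈) (cong ℤ.-_ (σ-neighbour A₂.s~t)))
                                       (trans (w-c₁ A₁.u∈) (σ-second A₁.s~t A₁.t~u)))) ℤ.-<+)
    where
    module A₁ = LongArm A₁
    module A₂ = LongArm A₂
    module A₃ = Arm A₃
    open Weighted A₁.class A₂.class A₃.class c₁∥c₂ c₁∥T c₂∥T

  -- The square `u` lies in the fourth class `c`, where `w` vanishes. The sign of `w t₁ + w u` is
  -- therefore that of `w t₁`, which is 1 on `c₁` and -1 on `c₂`.
  one-long : ∀ {c₁ c₂ T c} → Arm c₁ → Arm c₂ → Arm T → LongArm c →
             Disjoint c₁ c₂ → Disjoint c₁ T → Disjoint c₂ T →
             Disjoint c₁ c → Disjoint c₂ c → Disjoint T c → StronglyIrregular D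
  one-long A₁ A₂ A₃ A c₁∥c₂ c₁∥T c₂∥T c₁∥c c₂∥c T∥c = irregular
    (record { t₁ = A₁.t ; t₂ = A.t ; t₃ = A₃.t ; u = A.u ; s~t₁ = A₁.s~t ; s~t₂ = A.s~t ; s~t₃ = A₃.s~t
            ; t₂~u = A.t~u ; t₁∉T = c₁∥T A₁.t∈ ; t₂∉T = λ t∈T → T∥c t∈T A.t∈ ; t₃∈T = A₃.t∈
            ; t₁≢t₂ = distinct c₁∥c A₁.t∈ A.t∈ ; u≢s = A.u≢s
            ; u≢t₁ = distinct c₁∥c A₁.t∈ A.u∈ ∘ sym ; u≢t₃ = distinct T∥c A₃.t∈ A.u∈ ∘ sym })
    (record { t₁ = A₂.t ; t₂ = A.t ; t₃ = A₃.t ; u = A.u ; s~t₁ = A₂.s~t ; s~t₂ = A.s~t ; s~t₃ = A₃.s~t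
            ; t₂~u = A.t~u ; t₁∉T = c₂∥T A₂.t∈ ; t₂∉T = λ t∈T → T∥c t∈T A.t∈ ; t₃∈T = A₃.t∈
            ; t₁≢t₂ = distinct c₂∥c A₂.t∈ A.t∈ ; u≢s = A.u≢s
            ; u≢t₁ = distinct c₂∥c A₂.t∈ A.u∈ ∘ sym ; u≢t₃ = distinct T∥c A₃.t∈ A.u∈ ∘ sym })
    (subst (0ℤ ℤ.<_) (sym (cong₂ ℤ._+_ (trans (w-c₁ A₁.t∈) (σ-neighbour A₁.s~t)) w-u)) (ℤ.+<+ (s≤s z≤n)))
    (subst (ℤ._< 0ℤ) (sym (cong₂ ℤ._+_ (trans (w-c₂ A₂.t∈) (cong ℤ.-_ (σ-neighbour A₂.s~t))) w-u)) ℤ.-<+)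
    where
    module A₁ = Arm A₁
    module A₂ = Arm A₂
    module A₃ = Arm A₃
    module A  = LongArm A
    open Weighted A₁.class A₂.class A₃.class c₁∥c₂ c₁∥T c₂∥T
    w-u : w A.u ≡ 0ℤ
    w-u = w-other (λ u∈ → c₁∥c u∈ A.u∈) (λ u∈ → c₂∥c u∈ A.u∈)

  remainder : Subset size → Subset size → Subset size → Subset size
  remainder c₁ c₂ c₃ = ∁ (⁅ s ⁆ ∪ (c₁ ∪ (c₂ ∪ c₃)))

  module Three {c₁ c₂ c₃ : Subset size} (C₁ : Class c₁) (C₂ : Class c₂) (C₃ : Class c₃) where

    outside⇒∈ : ∀ {i} → i ≢ s → i ∉ c₁ → i ∉ c₂ → i ∉ c₃ → i ∈ remainder c₁ c₂ c₃
    outside⇒∈ i≢s i∉c₁ i∉c₂ i∉c₃ = x∉p⇒x∈∁p (∉-∪ (i≢s ∘ x∈⁅y⁆⇒x≡y s) (∉-∪ i∉c₁ (∉-∪ i∉c₂ i∉c₃)))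

    ∥-remainder : Disjoint c₁ (remainder c₁ c₂ c₃) × Disjoint c₂ (remainder c₁ c₂ c₃) ×
                  Disjoint c₃ (remainder c₁ c₂ c₃)
    ∥-remainder =
      (λ i∈ i∈R → x∈∁p⇒x∉p i∈R (x∈p∪q⁺ {p = ⁅ s ⁆} (inj₂ (x∈p∪q⁺ (inj₁ i∈))))) ,
      (λ i∈ i∈R → x∈∁p⇒x∉p i∈R (x∈p∪q⁺ {p = ⁅ s ⁆} (inj₂ (x∈p∪q⁺ {p = c₁} (inj₂ (x∈p∪q⁺ (inj₁ i∈))))))) ,
      (λ i∈ i∈R → x∈∁p⇒x∉p i∈R (x∈p∪q⁺ {p = ⁅ s ⁆} (inj₂ (x∈p∪q⁺ {p = c₁} (inj₂ (x∈p∪q⁺ {p = c₂} (inj₂ i∈)))))))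

    s∉remainder : s ∉ remainder c₁ c₂ c₃
    s∉remainder s∈R = x∈∁p⇒x∉p s∈R (x∈p∪q⁺ (inj₁ (x∈⁅x⁆ s)))

    remainder-class : Class (remainder c₁ c₂ c₃)
    remainder-class = record
      { s∉ = s∉remainder
      ; closed = λ i∈R i~j j≢s → let i≢s = λ { refl → s∉remainder i∈R } in outside⇒∈ j≢s
          (λ j∈ → proj₁ ∥-remainder (Class.closed C₁ j∈ (sym-adj i~j) i≢s) i∈R)
          (λ j∈ → proj₁ (proj₂ ∥-remainder) (Class.closed C₂ j∈ (sym-adj i~j) i≢s) i∈R)
          (λ j∈ → proj₂ (proj₂ ∥-remainder) (Class.closed C₃ j∈ (sym-adj i~j) i≢s) i∈R)
      }

    -- The square `s` and the classes `c₁` and `c₂` account for at most three squares outside `c₃`,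
    -- while at least four lie there.
    nonempty-remainder : card c₁ ≤ 1 → card c₂ ≤ 1 → card c₃ ℕ.+ 4 ≤ size → Nonempty (remainder c₁ c₂ c₃)
    nonempty-remainder c₁≤1 c₂≤1 c₃+4≤ = decidable-stable (nonempty? (remainder c₁ c₂ c₃)) λ empty →
      ℕ.<-irrefl refl (ℕ.≤-trans too-many (ℕ.≤-trans c₃+4≤ (ℕ.≤-trans (ℕ.≤-reflexive (sym (∣⊤∣≡n size)))
        (ℕ.≤-trans (p⊆q⇒∣p∣≤∣q∣ (covers empty)) few))))
      where
      covers : ¬ Nonempty (remainder c₁ c₂ c₃) → ⊤ ⊆ ⁅ s ⁆ ∪ (c₁ ∪ (c₂ ∪ c₃))
      covers empty {i} _ = decidable-stable (i ∈? _) λ i∉ → empty (i , x∉p⇒x∈∁p i∉)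
      few : card (⁅ s ⁆ ∪ (c₁ ∪ (c₂ ∪ c₃))) ≤ 3 ℕ.+ card c₃
      few = ℕ.≤-trans (card-∪ ⁅ s ⁆ _) (ℕ.+-mono-≤ (ℕ.≤-reflexive (∣⁅x⁆∣≡1 s))
        (ℕ.≤-trans (card-∪ c₁ _) (ℕ.+-mono-≤ c₁≤1 (ℕ.≤-trans (card-∪ c₂ c₃) (ℕ.+-monoˡ-≤ (card c₃) c₂≤1)))))
      too-many : 4 ℕ.+ card c₃ ≤ card c₃ ℕ.+ 4
      too-many = ℕ.≤-reflexive (ℕ.+-comm 4 (card c₃))

  Short : ∀ {c} → Arm c → Set
  Short {c} A = ∀ {j} → j ∈ c → j ≡ Arm.t A

  short⇒card : ∀ {c} (A : Arm c) → Short A → card c ≤ 1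
  short⇒card A short = ℕ.≤-trans (p⊆q⇒∣p∣≤∣q∣ λ {j} j∈c → subst (j ∈_) (cong ⁅_⁆ (short j∈c)) (x∈⁅x⁆ j))
    (ℕ.≤-reflexive (∣⁅x⁆∣≡1 (Arm.t A)))

  -- The squares outside `s` and the three components form a nonempty class, which takes the role of
  -- `T`; the long component is the fourth class.
  one-long-component : ∀ {c₁ c₂ c₃} (A₁ : Arm c₁) (A₂ : Arm c₂) → Short A₁ → Short A₂ → LongArm c₃ →
    card c₃ ℕ.+ 4 ≤ size → Disjoint c₁ c₂ → Disjoint c₁ c₃ → Disjoint c₂ c₃ → StronglyIrregular D
  one-long-component {c₁} {c₂} {c₃} A₁ A₂ short₁ short₂ A₃ small c₁∥c₂ c₁∥c₃ c₂∥c₃ =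
    one-long A₁ A₂ (record { class = remainder-class ; t∈ = proj₁ (proj₂ touch) ; s~t = proj₂ (proj₂ touch) }) A₃
      c₁∥c₂ (proj₁ ∥-remainder) (proj₁ (proj₂ ∥-remainder)) c₁∥c₃ c₂∥c₃
      (λ i∈R i∈c₃ → proj₂ (proj₂ ∥-remainder) i∈c₃ i∈R)
    where
    open Three (Arm.class A₁) (Arm.class A₂) (LongArm.class A₃)
    touch = Class.touches remainder-class
      (nonempty-remainder (short⇒card A₁ short₁) (short⇒card A₂ short₂) small)

  neighbour-colour : ∀ {i j} → Adj D i j → lookup (whites D) i ≡ not (lookup (whites D) j)
  neighbour-colour {i} {j} i~j
    rewrite lookup∘tabulate (λ k → does (color (square k) ℙ.≟ white)) i
          | lookup∘tabulate (λ k → does (color (square k) ℙ.≟ white)) j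
          | adjacent⇒color (square i) (square j) i~j
    with color (square j)
  ... | 0ℙ = refl
  ... | 1ℙ = refl

  -- Otherwise all squares but s would be neighbours of s, hence of the other colour.
  second-neighbour : ∀ {t t′} → Adj D s t → Adj D s t′ → t ≢ t′ →
                     ∃ λ t → ∃ λ u → Adj D s t × Adj D t u × u ≢ s
  second-neighbour {t₁} {t₂} s~t₁ s~t₂ t₁≢t₂ =
    decidable-stable (Fin.any? λ t → Fin.any? λ u → adj? s t ×-dec (adj? t u ×-dec ¬? (u Fin.≟ s))) λ none →
      unbalanced λ {j} → connected (λ i → (i Fin.≟ s) ⊎-dec adj? s i)
        (λ { (inj₁ refl) i~j → inj₂ i~j
           ; {i} {j} (inj₂ s~i) i~j → inj₁ (decidable-stable (j Fin.≟ s) λ j≢s → none (i , j , s~i , i~j , j≢s)) })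
        {s} {j} (inj₁ refl)
    where
    -- `X` is the colour class of `s` and `Y` the other one. If all squares are `s` or its
    -- neighbours, `X` has at most one square, while `Y` contains `t₁` and `t₂`.
    few : ∀ X Y → s ∈ X → (∀ {i} → Adj D s i → i ∉ X × i ∈ Y) → (∀ {j} → j ≡ s ⊎ Adj D s j) →
          card (⊤ ∩ X) ℕ.< card (⊤ ∩ Y)
    few X Y s∈X neighbours star = ℕ.≤-<-trans
      (ℕ.≤-trans (p⊆q⇒∣p∣≤∣q∣ (λ {j} j∈ → centre-only j (proj₂ (x∈p∩q⁻ ⊤ X j∈)) star))
        (ℕ.≤-reflexive (trans (∣⁅x⁆∣≡1 s) (sym (∣⁅x⁆∣≡1 t₁)))))
      (p⊂q⇒∣p∣<∣q∣ ((λ {j} j∈ → subst (_∈ ⊤ ∩ Y) (sym (x∈⁅y⁆⇒x≡y t₁ j∈)) (in-Y s~t₁)) ,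
        t₂ , in-Y s~t₂ , λ t₂∈ → t₁≢t₂ (sym (x∈⁅y⁆⇒x≡y t₁ t₂∈))))
      where
      in-Y : ∀ {t} → Adj D s t → t ∈ ⊤ ∩ Y
      in-Y s~t = x∈p∩q⁺ (∈⊤ , proj₂ (neighbours s~t))
      centre-only : ∀ j → j ∈ X → j ≡ s ⊎ Adj D s j → j ∈ ⁅ s ⁆
      centre-only j _   (inj₁ refl) = x∈⁅x⁆ s
      centre-only j j∈X (inj₂ s~j)  = contradiction j∈X (proj₁ (neighbours s~j))
    W = whites D
    opposite : ∀ {b i} → lookup W s ≡ b → Adj D s i → lookup W i ≡ not b
    opposite eq s~i = trans (neighbour-colour (sym-adj s~i)) (cong not eq)
    lookup-∁ : ∀ {b i} → lookup W i ≡ b → lookup (∁ W) i ≡ not b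
    lookup-∁ {i = i} eq = trans (lookup-map i not W) (cong not eq)
    by-colour : ∀ b → lookup W s ≡ b → (∀ {j} → j ≡ s ⊎ Adj D s j) → Empty.⊥
    by-colour true  eq star = ℕ.<-irrefl balanced-⊤ (few W (∁ W) (true⇒∈ eq)
      (λ s~i → false⇒∉ (opposite eq s~i) , true⇒∈ (lookup-∁ (opposite eq s~i))) star)
    by-colour false eq star = ℕ.<-irrefl (sym balanced-⊤) (few (∁ W) W (true⇒∈ (lookup-∁ eq))
      (λ s~i → false⇒∉ (lookup-∁ (opposite eq s~i)) , true⇒∈ (opposite eq s~i)) star)
    unbalanced : (∀ {j} → j ≡ s ⊎ Adj D s j) → Empty.⊥
    unbalanced = by-colour (lookup W s) refl

  -- A neighbour `t` of `s` with a further neighbour `u` cannot lie in a component with a single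
  -- square. Hence `t` is in the remainder, which becomes the long fourth class, with `c₃` as `T`.
  all-short : ∀ {c₁ c₂ c₃} (A₁ : Arm c₁) (A₂ : Arm c₂) (A₃ : Arm c₃) → Short A₁ → Short A₂ → Short A₃ →
    Disjoint c₁ c₂ → Disjoint c₁ c₃ → Disjoint c₂ c₃ → StronglyIrregular D
  all-short A₁ A₂ A₃ short₁ short₂ short₃ c₁∥c₂ c₁∥c₃ c₂∥c₃ =
    extend (second-neighbour (Arm.s~t A₁) (Arm.s~t A₂) (distinct c₁∥c₂ (Arm.t∈ A₁) (Arm.t∈ A₂)))
    where
    open Three (Arm.class A₁) (Arm.class A₂) (Arm.class A₃)
    not-short : ∀ {c t u} (A : Arm c) → Short A → Adj D t u → u ≢ s → t ∉ c
    not-short A short t~u u≢s t∈c = adj⇒≢ t~u (trans (short t∈c) (sym (short (Arm.closed A t∈c t~u u≢s))))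
    extend : (∃ λ t → ∃ λ u → Adj D s t × Adj D t u × u ≢ s) → StronglyIrregular D
    extend (t , u , s~t , t~u , u≢s) = one-long A₁ A₂ A₃
      (record { arm = record { class = remainder-class ; s~t = s~t
          ; t∈ = outside⇒∈ (adj⇒≢ s~t ∘ sym) (not-short A₁ short₁ t~u u≢s)
              (not-short A₂ short₂ t~u u≢s) (not-short A₃ short₃ t~u u≢s) }
        ; t~u = t~u ; u≢s = u≢s })
      c₁∥c₂ c₁∥c₃ c₂∥c₃ (proj₁ ∥-remainder) (proj₁ (proj₂ ∥-remainder)) (proj₂ (proj₂ ∥-remainder))

  -- Case distinction on the given components.

  Component : Subset size → Set
  Component = IsComponent D (∁ ⁅ s ⁆)

  module _ {c : Subset size} (K : Component c) where
    open IsComponent K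

    avoids-s : s ∉ c
    avoids-s s∈c = x∈∁p⇒x∉p (inside s∈c) (x∈⁅x⁆ s)

    ≢s⇒∈∁ : ∀ {i} → i ≢ s → i ∈ ∁ ⁅ s ⁆
    ≢s⇒∈∁ i≢s = x∉p⇒x∈∁p (i≢s ∘ x∈⁅y⁆⇒x≡y s)

    component-arm : Arm c
    component-arm = record { class = C ; t∈ = proj₁ (proj₂ touch) ; s~t = proj₂ (proj₂ touch) }
      where
      C : Class c
      C = record
        { s∉     = avoids-s
        ; closed = λ {i} {j} i∈c i~j j≢s → Equivalence.from (class i∈c j) ((inside i∈c , ≢s⇒∈∁ j≢s , i~j) ◅ ε)
        }
      touch = Class.touches C nonempty

    -- If `s` is the only possible neighbour of `t`, then no path in the complement of `s` leaves
    -- `t`, and the component is the single square `t`.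
    length-dichotomy : LongArm c ⊎ Short component-arm
    length-dichotomy = decide (Fin.any? λ u → adj? t u ×-dec ¬? (u Fin.≟ s))
      where
      open Arm component-arm using (t; t∈)
      decide : Dec (∃ λ u → Adj D t u × u ≢ s) → LongArm c ⊎ Short component-arm
      decide (yes (u , t~u , u≢s)) = inj₁ (record { arm = component-arm ; t~u = t~u ; u≢s = u≢s })
      decide (no none) = inj₂ λ {j} j∈c → first-step (Equivalence.to (class t∈ j) j∈c)
        where
        first-step : ∀ {j} → Connected D (∁ ⁅ s ⁆) t j → j ≡ t
        first-step ε = refl
        first-step ((_ , k∈ , t~k) ◅ _) = contradiction (_ , t~k , λ { refl → x∈∁p⇒x∉p k∈ (x∈⁅x⁆ s) }) none

  components-disjoint : ∀ {c d} → Component c → Component d → c ≢ d → Disjoint c d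
  components-disjoint {c} {d} K L c≢d {i} i∈c i∈d = c≢d (⊆-antisym
    (λ {j} j∈c → inclusion K L i∈c i∈d j∈c) (λ {j} j∈d → inclusion L K i∈d i∈c j∈d))
    where
    inclusion : ∀ {c d i j} → Component c → Component d → i ∈ c → i ∈ d → j ∈ c → j ∈ d
    inclusion {j = j} K L i∈c i∈d j∈c =
      Equivalence.from (IsComponent.class L i∈d j) (Equivalence.to (IsComponent.class K i∈c j) j∈c)

  -- Two long components suffice by themselves. With exactly one, the size bound is applied to that
  -- one; with none, the balance of `D` enters through `all-short`.
  irregularity : AtLeastThreeComponents D (∁ ⁅ s ⁆) →
                 (∀ c → Component c → card c ℕ.+ 4 ≤ size) → StronglyIrregular D
  irregularity (c₁ , c₂ , c₃ , K₁ , K₂ , K₃ , c₁≢c₂ , c₁≢c₃ , c₂≢c₃) small =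
    by-length (length-dichotomy K₁) (length-dichotomy K₂) (length-dichotomy K₃)
    where
    A₁ = component-arm K₁
    A₂ = component-arm K₂
    A₃ = component-arm K₃
    c₁∥c₂ : Disjoint c₁ c₂
    c₁∥c₂ = components-disjoint K₁ K₂ c₁≢c₂
    c₁∥c₃ : Disjoint c₁ c₃
    c₁∥c₃ = components-disjoint K₁ K₃ c₁≢c₃
    c₂∥c₃ : Disjoint c₂ c₃
    c₂∥c₃ = components-disjoint K₂ K₃ c₂≢c₃
    flipped : ∀ {c d} → Disjoint c d → Disjoint d c
    flipped c∥d i∈d i∈c = c∥d i∈c i∈d
    by-length : LongArm c₁ ⊎ Short A₁ → LongArm c₂ ⊎ Short A₂ → LongArm c₃ ⊎ Short A₃ →
                StronglyIrregular D
    by-length (inj₁ L₁) (inj₁ L₂) _         =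
      two-long L₁ L₂ A₃ c₁∥c₂ c₁∥c₃ c₂∥c₃
    by-length (inj₁ L₁) (inj₂ _)  (inj₁ L₃) =
      two-long L₁ L₃ A₂ c₁∥c₃ c₁∥c₂ (flipped c₂∥c₃)
    by-length (inj₂ _)  (inj₁ L₂) (inj₁ L₃) =
      two-long L₂ L₃ A₁ c₂∥c₃ (flipped c₁∥c₂) (flipped c₁∥c₃)
    by-length (inj₂ S₁) (inj₂ S₂) (inj₁ L₃) =
      one-long-component A₁ A₂ S₁ S₂ L₃ (small c₃ K₃) c₁∥c₂ c₁∥c₃ c₂∥c₃
    by-length (inj₂ S₁) (inj₁ L₂) (inj₂ S₃) =
      one-long-component A₁ A₃ S₁ S₃ L₂ (small c₂ K₂) c₁∥c₃ c₁∥c₂ (flipped c₂∥c₃)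
    by-length (inj₁ L₁) (inj₂ S₂) (inj₂ S₃) =
      one-long-component A₂ A₃ S₂ S₃ L₁ (small c₁ K₁) c₂∥c₃ (flipped c₁∥c₂) (flipped c₁∥c₃)
    by-length (inj₂ S₁) (inj₂ S₂) (inj₂ S₃) =
      all-short A₁ A₂ A₃ S₁ S₂ S₃ c₁∥c₂ c₁∥c₃ c₂∥c₃

open import Data.Fin.Subset using (∣_∣)

theorem3 : (D : Region) → IsQuadriculatedDisk D → Balanced D ⊤ →
    (s : Fin (Region.size D)) →
    AtLeastThreeComponents D (∁ ⁅ s ⁆) →
    (∀ (c : Subset (Region.size D)) → IsComponent D (∁ ⁅ s ⁆) c → ∣ c ∣ + 4 ≤ Region.size D) →
    StronglyIrregular D
theorem3 D disk balanced s = Theorem.irregularity D disk balanced s
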